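{- Let $k\geq 2$ be an even integer and let $G$ be a connected graph of order $n\geq 3$. (i) If $\lambda_1(D(G))\le \lambda_1(D(K_1\vee(K_{n-2}\cup K_1)))$ and $G\not\cong K_1\vee(K_{n-2}\cup K_1)$, then $G$ is $\mathrm{GFC}_k$ when $n$ is odd, and $G$ is $\mathrm{GBC}_k$ when $n$ is even with $n\geq 10$. (ii) If $n$ is even with $4\le n\le 8$ and $\lambda_1(D(G))\le \lambda_1(D(S_{n,\frac{n}{2}}))$, then $G$ is $\mathrm{GBC}_k$ unless $G\cong S_{n,\frac{n}{2}}$.
   Context: All graphs are finite, simple, undirected. For a connected graph $G$, $D(G)$ is its distance matrix (entry $(i,j)$ is the distance between $v_i$ and $v_j$) and $\lambda_1(D(G))$ its largest eigenvalue. $G\cup H$ is disjoint union, $G\vee H$ the join, $tK_1$ the edgeless graph on $t$ vertices, $S_{n,k}=K_k\vee(n-k)K_1$. For a graph $H$, $i(H)$ is the number of isolated vertices of $H$ and $\mathrm{odd}(H)$ the number of components of $H$ with an odd number ($\ge 3$) of vertices. The $k$-Berge–Tutte formula is $\mathrm{def}_k(G)=\max_{S\subseteq V(G)} \big(k\, i(G-S)-k|S|\big)$ if $k$ is even, and $\max_{S\subseteq V(G)}\big(\mathrm{odd}(G-S)+k\, i(G-S)-k|S|\big)$ if $k$ is odd; a set $S$ attaining the maximum is a $k$-barrier. A connected graph of odd order is $\mathrm{GFC}_k$ if it has no non-empty $k$-barrier; a connected graph of even order is $\mathrm{GBC}_k$ if it has no non-empty $k$-barrier. -}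

module Defs where

open import Data.Bool.Base using (Bool; true; false; T; not; if_then_else_)
open import Data.Bool.Properties using (T?)
open import Data.Fin.Base as Fin using (Fin; zero; suc; toℕ; splitAt; fromℕ<)
open import Data.Fin.Properties as Fin using (any?; all?; pigeonhole; toℕ<n; toℕ-fromℕ<)
open import Data.Fin.Subset using (Subset; inside; outside; ∁; ∣_∣; Nonempty)
open import Data.Integer.Base as ℤ using (ℤ; +_)
open import Data.List.Base using (List; length; filter; allFin)
open import Data.Nat.Base as ℕ using (ℕ; zero; suc; s≤s; _∸_; _⊔_)
open import Data.Nat.Divisibility using (_∣_; _∣?_)
open import Data.Nat.DivMod using (_/_)
open import Data.Nat.Induction using (<-rec)
import Data.Nat.Properties as ℕ
open import Data.Product.Base using (Σ; ∃; _×_; _,_)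
open import Data.Rational.Base as ℚ using (ℚ; 0ℚ; 1ℚ; ½)
import Data.Rational.Properties as ℚ
open import Data.Rational.Solver using (module +-*-Solver)
open import Data.Sum.Base using (_⊎_; inj₁; inj₂)
open import Data.Vec.Base using (Vec; []; _∷_)
open import Data.Vec.Functional as VF using (Vector)
open import Function.Base using (_∘_)
open import Function.Bundles using (_↔_; Inverse)
open import Relation.Binary.Definitions using (Decidable)
open import Relation.Binary.PropositionalEquality
  using (_≡_; refl; sym; trans; cong; subst)
open import Relation.Nullary using (¬_; Dec; yes; no; does; contradiction)
open import Relation.Nullary.Decidable using (map′; _×-dec_; _→-dec_; ¬?; ⌊_⌋)

record Graph (n : ℕ) : Set where
  field
    adj        : Fin n → Fin n → Bool
    adj-sym    : ∀ u v → adj u v ≡ adj v u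
    adj-irrefl : ∀ u → adj u u ≡ false

  Adj : Fin n → Fin n → Set
  Adj u v = T (adj u v)

  adj? : Decidable Adj
  adj? u v = T? (adj u v)

open Graph public

infix 4 _≅_

_≅_ : ∀ {m n} → Graph m → Graph n → Set
_≅_ {m} {n} G H =
  Σ (Fin m ↔ Fin n) λ f → ∀ u v → adj G u v ≡ adj H (Inverse.to f u) (Inverse.to f v)

K : ∀ n → Graph n
K n = record
  { adj        = λ u v → not ⌊ u Fin.≟ v ⌋
  ; adj-sym    = symm
  ; adj-irrefl = irr
  }
  where
  symm : (u v : Fin n) → not ⌊ u Fin.≟ v ⌋ ≡ not ⌊ v Fin.≟ u ⌋
  symm u v with u Fin.≟ v | v Fin.≟ u
  ... | yes _ | yes _ = refl
  ... | no _  | no _  = refl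
  ... | yes p | no ¬q = contradiction (sym p) ¬q
  ... | no ¬p | yes q = contradiction (sym q) ¬p
  irr : (u : Fin n) → not ⌊ u Fin.≟ u ⌋ ≡ false
  irr u with u Fin.≟ u
  ... | yes _ = refl
  ... | no ¬p = contradiction refl ¬p

edgeless : ∀ n → Graph n
edgeless n = record
  { adj = λ _ _ → false ; adj-sym = λ _ _ → refl ; adj-irrefl = λ _ → refl }

-- Vertices of G come first in both sums; the Boolean says whether the two
-- sides are completely joined.
glue : ∀ {m n} → Bool → Graph m → Graph n → Graph (m ℕ.+ n)
glue {m} {n} b G H = record
  { adj        = λ u v → e (splitAt m u) (splitAt m v)
  ; adj-sym    = λ u v → e-sym (splitAt m u) (splitAt m v)
  ; adj-irrefl = λ u → e-irrefl (splitAt m u)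
  }
  where
  e : Fin m ⊎ Fin n → Fin m ⊎ Fin n → Bool
  e (inj₁ u) (inj₁ v) = adj G u v
  e (inj₂ u) (inj₂ v) = adj H u v
  e (inj₁ _) (inj₂ _) = b
  e (inj₂ _) (inj₁ _) = b
  e-sym : ∀ x y → e x y ≡ e y x
  e-sym (inj₁ u) (inj₁ v) = adj-sym G u v
  e-sym (inj₂ u) (inj₂ v) = adj-sym H u v
  e-sym (inj₁ _) (inj₂ _) = refl
  e-sym (inj₂ _) (inj₁ _) = refl
  e-irrefl : ∀ x → e x x ≡ false
  e-irrefl (inj₁ u) = adj-irrefl G u
  e-irrefl (inj₂ u) = adj-irrefl H u

infixr 6 _∪ᴳ_ _∨ᴳ_

_∪ᴳ_ _∨ᴳ_ : ∀ {m n} → Graph m → Graph n → Graph (m ℕ.+ n)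
_∪ᴳ_ = glue false
_∨ᴳ_ = glue true

S[_,_] : ∀ n k → Graph (k ℕ.+ (n ∸ k))
S[ n , k ] = K k ∨ᴳ edgeless (n ∸ k)

-- The increasing enumeration of the elements of a subset.
embed : ∀ {n} (S : Subset n) → Fin ∣ S ∣ → Fin n
embed (inside  ∷ S) zero    = zero
embed (inside  ∷ S) (suc i) = suc (embed S i)
embed (outside ∷ S) i       = suc (embed S i)

infixl 5 _∖_

_∖_ : ∀ {n} → Graph n → (S : Subset n) → Graph ∣ ∁ S ∣
G ∖ S = record
  { adj        = λ u v → adj G (embed (∁ S) u) (embed (∁ S) v)
  ; adj-sym    = λ u v → adj-sym G (embed (∁ S) u) (embed (∁ S) v)
  ; adj-irrefl = λ u → adj-irrefl G (embed (∁ S) u)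
  }

data Walk {n} (G : Graph n) : ℕ → Fin n → Fin n → Set where
  []  : ∀ {u} → Walk G 0 u u
  _∷_ : ∀ {d u v w} → Adj G u v → Walk G d v w → Walk G (suc d) u w

Reachable : ∀ {n} → Graph n → Fin n → Fin n → Set
Reachable G u v = ∃ λ d → Walk G d u v

Connected : ∀ {n} → Graph n → Set
Connected G = ∀ u v → Reachable G u v

walk? : ∀ {n} (G : Graph n) d → Decidable (Walk G d)
walk? G zero u v = map′ (λ { refl → [] }) (λ { [] → refl }) (u Fin.≟ v)
walk? G (suc d) u v =
  map′ (λ { (_ , a , p) → a ∷ p }) (λ { (a ∷ p) → _ , a , p })
       (any? (λ x → adj? G u x ×-dec walk? G d x v))

module _ {n} {G : Graph n} where

  private
    at : ∀ {d u v} → Walk G d u v → Fin (suc d) → Fin n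
    at {u = u} _       zero    = u
    at         (_ ∷ p) (suc i) = at p i

    take : ∀ {d u v} (p : Walk G d u v) i → Walk G (toℕ i) u (at p i)
    take p       zero    = []
    take (a ∷ p) (suc i) = a ∷ take p i

    drop : ∀ {d u v} (p : Walk G d u v) i → Walk G (d ∸ toℕ i) (at p i) v
    drop p       zero    = p
    drop (_ ∷ p) (suc i) = drop p i

    _++_ : ∀ {d e u v w} → Walk G d u v → Walk G e v w → Walk G (d ℕ.+ e) u w
    []      ++ q = q
    (a ∷ p) ++ q = a ∷ (p ++ q)

  shorten : ∀ d {u v} → Walk G d u v → ∃ λ e → e ℕ.< n × Walk G e u v
  shorten = <-rec _ go
    where
    go : ∀ d → (∀ {d′} → d′ ℕ.< d → ∀ {u v} → Walk G d′ u v → ∃ λ e → e ℕ.< n × Walk G e u v) →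
         ∀ {u v} → Walk G d u v → ∃ λ e → e ℕ.< n × Walk G e u v
    go d rec p with d ℕ.<? n
    ... | yes d<n = d , d<n , p
    ... | no d≮n with i , j , i<j , eq ← pigeonhole (s≤s (ℕ.≮⇒≥ d≮n)) (at p) =
      rec shorter (take p i ++ subst (λ x → Walk G _ x _) (sym eq) (drop p j))
      where
      shorter : toℕ i ℕ.+ (d ∸ toℕ j) ℕ.< d
      shorter = ℕ.<-≤-trans (ℕ.+-monoˡ-< (d ∸ toℕ j) i<j)
        (ℕ.≤-reflexive (ℕ.m+[n∸m]≡n (ℕ.≤-pred (toℕ<n j))))

reachable? : ∀ {n} (G : Graph n) → Decidable (Reachable G)
reachable? {n} G u v = map′ (λ { (d , p) → toℕ d , p }) back
                            (any? {n = n} (λ d → walk? G (toℕ d) u v))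
  where
  back : Reachable G u v → ∃ λ (d : Fin n) → Walk G (toℕ d) u v
  back (d , p) with e , e<n , q ← shorten d p =
    fromℕ< e<n , subst (λ x → Walk G x u v) (sym (toℕ-fromℕ< e<n)) q

-- The least d < b with P d, or b if there is none.
least : {P : ℕ → Set} → (∀ d → Dec (P d)) → ℕ → ℕ
least P? zero    = zero
least P? (suc b) = if does (P? 0) then 0 else suc (least (P? ∘ suc) b)

-- The bound n is harmless by `shorten`; see `dist-walk` and `dist-minimal`.
dist : ∀ {n} → Graph n → Fin n → Fin n → ℕ
dist {n} G u v = least (λ d → walk? G d u v) n

least-≤ : {P : ℕ → Set} (P? : ∀ d → Dec (P d)) (b : ℕ) {d : ℕ} → P d → least P? b ℕ.≤ d
least-≤ P? zero    _ = ℕ.z≤n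
least-≤ P? (suc b) {d} p with P? 0
least-≤ P? (suc b) {d}     p | yes _ = ℕ.z≤n
least-≤ P? (suc b) {zero}  p | no ¬p = contradiction p ¬p
least-≤ P? (suc b) {suc d} p | no _  = s≤s (least-≤ (P? ∘ suc) b p)

least-holds : {P : ℕ → Set} (P? : ∀ d → Dec (P d)) (b : ℕ) {d : ℕ} →
              d ℕ.< b → P d → P (least P? b)
least-holds P? (suc b) {d} d<b p with P? 0
least-holds P? (suc b) {d}     d<b       p | yes p₀ = p₀
least-holds P? (suc b) {zero}  d<b       p | no ¬p  = contradiction p ¬p
least-holds P? (suc b) {suc d} (s≤s d<b) p | no _   = least-holds (P? ∘ suc) b d<b p

dist-minimal : ∀ {n} (G : Graph n) {d u v} → Walk G d u v → dist G u v ℕ.≤ d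
dist-minimal {n} G p = least-≤ (λ d → walk? G d _ _) n p

dist-walk : ∀ {n} (G : Graph n) {u v} → Reachable G u v → Walk G (dist G u v) u v
dist-walk {n} G (d , p) with e , e<n , q ← shorten d p =
  least-holds (λ d → walk? G d _ _) n e<n q

isolated? : ∀ {n} (G : Graph n) v → Dec (∀ u → ¬ Adj G v u)
isolated? G v = all? (λ u → ¬? (adj? G v u))

i[_] : ∀ {n} → Graph n → ℕ
i[_] {n} G = length (filter (isolated? G) (allFin n))

component : ∀ {n} → Graph n → Fin n → List (Fin n)
component {n} G v = filter (reachable? G v) (allFin n)

-- Components are counted through their least vertices.
OddRoot : ∀ {n} → Graph n → Fin n → Set
OddRoot G v = (∀ u → Reachable G v u → v Fin.≤ u)
            × ¬ 2 ∣ length (component G v)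
            × 3 ℕ.≤ length (component G v)

oddRoot? : ∀ {n} (G : Graph n) v → Dec (OddRoot G v)
oddRoot? G v = all? (λ u → reachable? G v u →-dec (v Fin.≤? u))
         ×-dec ¬? (2 ∣? length (component G v))
         ×-dec (3 ℕ.≤? length (component G v))

odd[_] : ∀ {n} → Graph n → ℕ
odd[_] {n} G = length (filter (oddRoot? G) (allFin n))

maxOverSubsets : ∀ {n} → (Subset n → ℤ) → ℤ
maxOverSubsets {zero}  f = f []
maxOverSubsets {suc n} f =
  maxOverSubsets (f ∘ (inside ∷_)) ℤ.⊔ maxOverSubsets (f ∘ (outside ∷_))

bergeTutte : ∀ {n} → ℕ → Graph n → Subset n → ℤ
bergeTutte k G S =
  if does (2 ∣? k)
  then + (k ℕ.* i[ G ∖ S ]) ℤ.- + (k ℕ.* ∣ S ∣)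
  else + (odd[ G ∖ S ] ℕ.+ k ℕ.* i[ G ∖ S ]) ℤ.- + (k ℕ.* ∣ S ∣)

def : ∀ {n} → ℕ → Graph n → ℤ
def k G = maxOverSubsets (bergeTutte k G)

IsBarrier : ∀ {n} → ℕ → Graph n → Subset n → Set
IsBarrier k G S = bergeTutte k G S ≡ def k G

GFC GBC : ∀ {n} → ℕ → Graph n → Set
GFC {n} k G = Connected G × ¬ 2 ∣ n × ¬ (∃ λ S → Nonempty S × IsBarrier k G S)
GBC {n} k G = Connected G × 2 ∣ n × ¬ (∃ λ S → Nonempty S × IsBarrier k G S)

Cauchy : (ℕ → ℚ) → Set
Cauchy s = ∀ ε → 0ℚ ℚ.< ε →
  ∃ λ N → ∀ m n → N ℕ.≤ m → N ℕ.≤ n → ℚ.∣ s m ℚ.- s n ∣ ℚ.< ε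

-- Representatives of reals; _≃_ is their equality.
record ℝ : Set where
  constructor mkℝ
  field
    seq    : ℕ → ℚ
    cauchy : Cauchy seq

open ℝ public

infix 4 _≃_ _≤_

_≃_ _≤_ : ℝ → ℝ → Set
x ≃ y = ∀ ε → 0ℚ ℚ.< ε → ∃ λ N → ∀ n → N ℕ.≤ n → ℚ.∣ seq x n ℚ.- seq y n ∣ ℚ.< ε
x ≤ y = ∀ ε → 0ℚ ℚ.< ε → ∃ λ N → ∀ n → N ℕ.≤ n → seq x n ℚ.< seq y n ℚ.+ ε

fromℚ : ℚ → ℝ
fromℚ q = mkℝ (λ _ → q) λ ε 0<ε → 0 , λ _ _ _ _ →
  subst (λ r → ℚ.∣ r ∣ ℚ.< ε) (sym (ℚ.+-inverseʳ q)) 0<ε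

fromℕ : ℕ → ℝ
fromℕ n = fromℚ (+ n ℚ./ 1)

0ℝ : ℝ
0ℝ = fromℚ 0ℚ

+-cauchy : ∀ {s t} → Cauchy s → Cauchy t → Cauchy (λ n → s n ℚ.+ t n)
+-cauchy {s} {t} cs ct ε 0<ε
  with 0<½ε ← subst (ℚ._< ½ ℚ.* ε) (ℚ.*-zeroʳ ½) (ℚ.*-monoʳ-<-pos ½ 0<ε)
  with M , hM ← cs (½ ℚ.* ε) 0<½ε
  with N , hN ← ct (½ ℚ.* ε) 0<½ε
  = M ⊔ N , λ m n p q → begin-strict
    ℚ.∣ (s m ℚ.+ t m) ℚ.- (s n ℚ.+ t n) ∣
      ≡⟨ cong ℚ.∣_∣ (regroup (s m) (t m) (s n) (t n)) ⟩
    ℚ.∣ (s m ℚ.- s n) ℚ.+ (t m ℚ.- t n) ∣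
      ≤⟨ ℚ.∣p+q∣≤∣p∣+∣q∣ (s m ℚ.- s n) (t m ℚ.- t n) ⟩
    ℚ.∣ s m ℚ.- s n ∣ ℚ.+ ℚ.∣ t m ℚ.- t n ∣
      <⟨ ℚ.+-mono-< (hM m n (ℕ.m⊔n≤o⇒m≤o M N p) (ℕ.m⊔n≤o⇒m≤o M N q))
                    (hN m n (ℕ.m⊔n≤o⇒n≤o M N p) (ℕ.m⊔n≤o⇒n≤o M N q)) ⟩
    ½ ℚ.* ε ℚ.+ ½ ℚ.* ε
      ≡⟨ ℚ.*-distribʳ-+ ε ½ ½ ⟨
    1ℚ ℚ.* ε
      ≡⟨ ℚ.*-identityˡ ε ⟩
    ε ∎
  where
  open ℚ.≤-Reasoning
  open +-*-Solver
  regroup : ∀ a b c d → (a ℚ.+ b) ℚ.- (c ℚ.+ d) ≡ (a ℚ.- c) ℚ.+ (b ℚ.- d)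
  regroup = solve 4 (λ a b c d → (a :+ b) :- (c :+ d) := (a :- c) :+ (b :- d)) refl

bounded : ∀ {s} → Cauchy s →
          ∃ λ B → ℚ.Positive B × ∃ λ N → ∀ n → N ℕ.≤ n → ℚ.∣ s n ∣ ℚ.≤ B
bounded {s} cs with N , h ← cs 1ℚ (ℚ.positive⁻¹ 1ℚ) =
  B , B>0 , N , λ n p → begin
    ℚ.∣ s n ∣                              ≡⟨ cong ℚ.∣_∣ (split (s n) (s N)) ⟩
    ℚ.∣ s N ℚ.+ (s n ℚ.- s N) ∣            ≤⟨ ℚ.∣p+q∣≤∣p∣+∣q∣ (s N) (s n ℚ.- s N) ⟩
    ℚ.∣ s N ∣ ℚ.+ ℚ.∣ s n ℚ.- s N ∣        ≤⟨ ℚ.+-monoʳ-≤ ℚ.∣ s N ∣ (ℚ.<⇒≤ (h n N p ℕ.≤-refl)) ⟩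
    B ∎
  where
  open ℚ.≤-Reasoning
  open +-*-Solver
  B = ℚ.∣ s N ∣ ℚ.+ 1ℚ
  B>0 : ℚ.Positive B
  B>0 = ℚ.positive (ℚ.+-mono-≤-< (ℚ.0≤∣p∣ (s N)) (ℚ.positive⁻¹ 1ℚ))
  split : ∀ a b → a ≡ b ℚ.+ (a ℚ.- b)
  split = solve 2 (λ a b → a := b :+ (a :- b)) refl

quotient : ∀ C ε → ℚ.Positive C → 0ℚ ℚ.< ε → ∃ λ δ → 0ℚ ℚ.< δ × C ℚ.* δ ≡ ε
quotient C ε C>0 0<ε = r ℚ.* ε , 0<δ , Cδ≡ε
  where
  instance
    _ = ℚ.pos⇒nonZero C {{C>0}}
    _ = ℚ.1/pos⇒pos C {{C>0}}
  r = ℚ.1/ C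
  0<δ : 0ℚ ℚ.< r ℚ.* ε
  0<δ = subst (ℚ._< r ℚ.* ε) (ℚ.*-zeroʳ r) (ℚ.*-monoʳ-<-pos r 0<ε)
  Cδ≡ε : C ℚ.* (r ℚ.* ε) ≡ ε
  Cδ≡ε = trans (sym (ℚ.*-assoc C r ε))
    (trans (cong (ℚ._* ε) (ℚ.*-inverseʳ C)) (ℚ.*-identityˡ ε))

product-< : ∀ {E δ} a b → ℚ.Positive E → ℚ.∣ a ∣ ℚ.≤ E → ℚ.∣ b ∣ ℚ.< δ →
            ℚ.∣ a ℚ.* b ∣ ℚ.< E ℚ.* δ
product-< {E} {δ} a b E>0 a≤E b<δ = begin-strict
  ℚ.∣ a ℚ.* b ∣           ≡⟨ ℚ.∣p*q∣≡∣p∣*∣q∣ a b ⟩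
  ℚ.∣ a ∣ ℚ.* ℚ.∣ b ∣     ≤⟨ ℚ.*-monoʳ-≤-nonNeg ℚ.∣ b ∣ {{ℚ.nonNegative (ℚ.0≤∣p∣ b)}} a≤E ⟩
  E ℚ.* ℚ.∣ b ∣           <⟨ ℚ.*-monoʳ-<-pos E {{E>0}} b<δ ⟩
  E ℚ.* δ                 ∎
  where open ℚ.≤-Reasoning

*-split : ∀ a b c d → a ℚ.* b ℚ.- c ℚ.* d ≡ a ℚ.* (b ℚ.- d) ℚ.+ d ℚ.* (a ℚ.- c)
*-split = solve 4 (λ a b c d → a :* b :- c :* d := a :* (b :- d) :+ d :* (a :- c)) refl
  where open +-*-Solver

product-close : ∀ {A B δ} a b c d → ℚ.Positive A → ℚ.Positive B →
                ℚ.∣ a ∣ ℚ.≤ A → ℚ.∣ d ∣ ℚ.≤ B →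
                ℚ.∣ a ℚ.- c ∣ ℚ.< δ → ℚ.∣ b ℚ.- d ∣ ℚ.< δ →
                ℚ.∣ a ℚ.* b ℚ.- c ℚ.* d ∣ ℚ.< (A ℚ.+ B) ℚ.* δ
product-close {A} {B} {δ} a b c d A>0 B>0 a≤A d≤B ac bd = begin-strict
  ℚ.∣ a ℚ.* b ℚ.- c ℚ.* d ∣
    ≡⟨ cong ℚ.∣_∣ (*-split a b c d) ⟩
  ℚ.∣ a ℚ.* (b ℚ.- d) ℚ.+ d ℚ.* (a ℚ.- c) ∣
    ≤⟨ ℚ.∣p+q∣≤∣p∣+∣q∣ (a ℚ.* (b ℚ.- d)) (d ℚ.* (a ℚ.- c)) ⟩
  ℚ.∣ a ℚ.* (b ℚ.- d) ∣ ℚ.+ ℚ.∣ d ℚ.* (a ℚ.- c) ∣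
    <⟨ ℚ.+-mono-< (product-< a (b ℚ.- d) A>0 a≤A bd) (product-< d (a ℚ.- c) B>0 d≤B ac) ⟩
  A ℚ.* δ ℚ.+ B ℚ.* δ
    ≡⟨ ℚ.*-distribʳ-+ δ A B ⟨
  (A ℚ.+ B) ℚ.* δ ∎
  where open ℚ.≤-Reasoning

*-cauchy : ∀ {s t} → Cauchy s → Cauchy t → Cauchy (λ n → s n ℚ.* t n)
*-cauchy {s} {t} cs ct ε 0<ε =
  let A , A>0 , L , hA = bounded cs
      B , B>0 , M , hB = bounded ct
      δ , 0<δ , Cδ≡ε   = quotient (A ℚ.+ B) ε (ℚ.pos+pos⇒pos A {{A>0}} B {{B>0}}) 0<ε
      P , hP           = cs δ 0<δ
      Q , hQ           = ct δ 0<δ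
  in (L ⊔ M) ⊔ (P ⊔ Q) , λ m n p q →
    let LM≤m = ℕ.m⊔n≤o⇒m≤o (L ⊔ M) (P ⊔ Q) p
        LM≤n = ℕ.m⊔n≤o⇒m≤o (L ⊔ M) (P ⊔ Q) q
        PQ≤m = ℕ.m⊔n≤o⇒n≤o (L ⊔ M) (P ⊔ Q) p
        PQ≤n = ℕ.m⊔n≤o⇒n≤o (L ⊔ M) (P ⊔ Q) q
    in subst (ℚ.∣ s m ℚ.* t m ℚ.- s n ℚ.* t n ∣ ℚ.<_) Cδ≡ε
      (product-close (s m) (t m) (s n) (t n) A>0 B>0
        (hA m (ℕ.m⊔n≤o⇒m≤o L M LM≤m)) (hB n (ℕ.m⊔n≤o⇒n≤o L M LM≤n))
        (hP m n (ℕ.m⊔n≤o⇒m≤o P Q PQ≤m) (ℕ.m⊔n≤o⇒m≤o P Q PQ≤n))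
        (hQ m n (ℕ.m⊔n≤o⇒n≤o P Q PQ≤m) (ℕ.m⊔n≤o⇒n≤o P Q PQ≤n)))

infixl 6 _+_
infixl 7 _*_

_+_ _*_ : ℝ → ℝ → ℝ
x + y = mkℝ (λ n → seq x n ℚ.+ seq y n) (+-cauchy {seq x} {seq y} (cauchy x) (cauchy y))
x * y = mkℝ (λ n → seq x n ℚ.* seq y n) (*-cauchy {seq x} {seq y} (cauchy x) (cauchy y))

Matrix : ℕ → Set
Matrix n = Fin n → Fin n → ℝ

∑ : ∀ {n} → Vector ℝ n → ℝ
∑ = VF.foldr _+_ 0ℝ

IsEigenvalue : ∀ {n} → Matrix n → ℝ → Set
IsEigenvalue {n} A μ = ∃ λ (x : Vector ℝ n) →
  ¬ (∀ i → x i ≃ 0ℝ) × (∀ i → ∑ (λ j → A i j * x j) ≃ μ * x i)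

-- λ₁ is given by its defining property, which determines μ up to _≃_.
IsLargestEigenvalue : ∀ {n} → Matrix n → ℝ → Set
IsLargestEigenvalue A μ = IsEigenvalue A μ × (∀ ν → IsEigenvalue A ν → ν ≤ μ)

D : ∀ {n} → Graph n → Matrix n
D G u v = fromℕ (dist G u v)

-- For even k, a non-empty k-barrier S satisfies i(G - S) ≥ |S| = s ≥ 1, so G is
-- a spanning subgraph of H_s = K_s ∨ (K_t ∪ s K₁) with t = n - 2s.  Distances
-- in G then dominate those in H_s, and everything reduces to comparing largest
-- distance eigenvalues.
--
-- Power iteration with D + I, all of whose entries are positive, contracts the
-- bounds l v ≤ y ≤ u v geometrically, which produces the Perron eigenpair of D
-- as explicit Cauchy sequences.  Hence a rational q and rational vectors
-- z, w > 0 with D(G) z > q z and D(H) w ≤ q w separate the largest eigenvalue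
-- of D(G) from every eigenvalue of D(H).  If G is a proper spanning subgraph of
-- H, such data come from power iteration for H, since a single excess entry of
-- D(G) spreads over all coordinates.  For H_s against the extremal graph they
-- are explicit vectors constant on the three classes of vertices.
module Submission where

-- The order of the Cauchy reals is not decidable, so no extremal real vector can be picked and
-- Rayleigh quotients are out of reach. The refutation of `α ≤ β` therefore runs through a rational
-- threshold with a fixed margin. The two sides of the threshold are of different kinds. A bound
-- from above concerns an arbitrary eigenvector and can be checked on its rational approximations,
-- where maxima are decidable. A bound from below uses that `α` dominates every eigenvalue, which
-- helps only once some eigenvalue is exhibited; this is what power iteration is for. The comparison
-- of H_s, s ≥ 2, with the extremal graph is an infinite family in (s, t). It becomes manageable
-- because n + 2 bounds the distance spectral radius of the extremal graph and lies below that of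
-- H_s for all but finitely many pairs. The orders 4, 6 and 8 stand apart because there the graph
-- with s = n / 2 has a smaller radius than the one with s = 1.

module SpectralComparison where
  import Algebra.Properties.Semiring.Sum as SemiringSum
  open import Algebra.Bundles using (CommutativeRing)
  open import Data.Bool.Base using (if_then_else_)
  open import Data.Fin.Base using (Fin; zero; suc)
  open import Data.Fin.Permutation using (Permutation; _⟨$⟩ʳ_)
  import Data.Fin.Properties as Fin
  open import Data.Integer.Base as ℤ using ()
  import Data.Integer.Properties as ℤ
  open import Data.Nat.Base as ℕ using (ℕ; zero; suc)
  import Data.Nat.Properties as ℕ
  open import Data.Product.Base using (∃; ∃₂; _×_; _,_; proj₁; proj₂)
  open import Data.Rational.Base hiding (_≃_)
  open import Data.Rational.Properties
  open import Data.Rational.Solver using (module +-*-Solver)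
  import Data.Rational.Unnormalised.Base as ℚᵘ
  import Data.Rational.Unnormalised.Properties as ℚᵘ
  open import Data.Sum.Base using (inj₁; inj₂)
  open import Data.Vec.Functional using (Vector)
  open import Function.Base using (_∘_)
  open import Relation.Binary.PropositionalEquality
  open import Relation.Nullary using (¬_; yes; no; does)
  import Defs
  open Defs using (ℝ; mkℝ; seq; cauchy; Cauchy; _≃_; fromℚ; ∑; IsEigenvalue; IsLargestEigenvalue;
                   quotient; bounded; product-<)

  open SemiringSum (CommutativeRing.semiring +-*-commutativeRing)
    using (sum; sum-cong-≗; ∑-distrib-+; *-distribˡ-sum; *-distribʳ-sum; sum-permute)
  open +-*-Solver

  -- Naturals inside the rationals, order arithmetic and finite sums.

  ι : ℕ → ℚ
  ι n = ℤ.+ n / 1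

  -- `_/_` normalises by a gcd, so the homomorphism laws of `ι` do not hold by computation. They are
  -- checked on unnormalised fractions with denominator 1.
  toℚᵘ-ι : ∀ n → toℚᵘ (ι n) ℚᵘ.≃ ℚᵘ.mkℚᵘ (ℤ.+ n) 0
  toℚᵘ-ι n = toℚᵘ-fromℚᵘ (ℚᵘ.mkℚᵘ (ℤ.+ n) 0)

  ι-+ : ∀ m n → ι (m ℕ.+ n) ≡ ι m + ι n
  ι-+ m n = toℚᵘ-injective (begin
    toℚᵘ (ι (m ℕ.+ n))                          ≈⟨ toℚᵘ-ι (m ℕ.+ n) ⟩
    ℚᵘ.mkℚᵘ (ℤ.+ (m ℕ.+ n)) 0                     ≈⟨ ℚᵘ.*≡* (cong (ℤ._* ℤ.+ 1) (cong₂ ℤ._+_ (sym (ℤ.*-identityʳ (ℤ.+ m))) (sym (ℤ.*-identityʳ (ℤ.+ n))))) ⟩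
    ℚᵘ.mkℚᵘ (ℤ.+ m) 0 ℚᵘ.+ ℚᵘ.mkℚᵘ (ℤ.+ n) 0        ≈⟨ ℚᵘ.+-cong (toℚᵘ-ι m) (toℚᵘ-ι n) ⟨
    toℚᵘ (ι m) ℚᵘ.+ toℚᵘ (ι n)                  ≈⟨ toℚᵘ-homo-+ (ι m) (ι n) ⟨
    toℚᵘ (ι m + ι n)                            ∎)
    where open ℚᵘ.≃-Reasoning

  ι-* : ∀ m n → ι (m ℕ.* n) ≡ ι m * ι n
  ι-* m n = toℚᵘ-injective (begin
    toℚᵘ (ι (m ℕ.* n))                          ≈⟨ toℚᵘ-ι (m ℕ.* n) ⟩
    ℚᵘ.mkℚᵘ (ℤ.+ (m ℕ.* n)) 0                     ≈⟨ ℚᵘ.*≡* (cong (ℤ._* ℤ.+ 1) (ℤ.pos-* m n)) ⟩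
    ℚᵘ.mkℚᵘ (ℤ.+ m) 0 ℚᵘ.* ℚᵘ.mkℚᵘ (ℤ.+ n) 0        ≈⟨ ℚᵘ.*-cong (toℚᵘ-ι m) (toℚᵘ-ι n) ⟨
    toℚᵘ (ι m) ℚᵘ.* toℚᵘ (ι n)                  ≈⟨ toℚᵘ-homo-* (ι m) (ι n) ⟨
    toℚᵘ (ι m * ι n)                            ∎)
    where open ℚᵘ.≃-Reasoning

  ι-mono-≤ : ∀ {m n} → m ℕ.≤ n → ι m ≤ ι n
  ι-mono-≤ {m} {n} m≤n = toℚᵘ-cancel-≤ (begin
    toℚᵘ (ι m)       ≃⟨ toℚᵘ-ι m ⟩
    ℚᵘ.mkℚᵘ (ℤ.+ m) 0  ≤⟨ ℚᵘ.*≤* (ℤ.*-monoʳ-≤-nonNeg (ℤ.+ 1) (ℤ.+≤+ m≤n)) ⟩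
    ℚᵘ.mkℚᵘ (ℤ.+ n) 0  ≃⟨ toℚᵘ-ι n ⟨
    toℚᵘ (ι n)       ∎)
    where open ℚᵘ.≤-Reasoning

  ι-mono-< : ∀ {m n} → m ℕ.< n → ι m < ι n
  ι-mono-< {m} {n} m<n = toℚᵘ-cancel-< (begin-strict
    toℚᵘ (ι m)       ≃⟨ toℚᵘ-ι m ⟩
    ℚᵘ.mkℚᵘ (ℤ.+ m) 0  <⟨ ℚᵘ.*<* (ℤ.*-monoʳ-<-pos (ℤ.+ 1) (ℤ.+<+ m<n)) ⟩
    ℚᵘ.mkℚᵘ (ℤ.+ n) 0  ≃⟨ toℚᵘ-ι n ⟨
    toℚᵘ (ι n)       ∎)
    where open ℚᵘ.≤-Reasoning

  ι-nonneg : ∀ n → 0ℚ ≤ ι n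
  ι-nonneg n = ι-mono-≤ {0} {n} ℕ.z≤n

  archimedean : ∀ q → ∃ λ n → q ≤ ι n
  archimedean q@(mkℚ n d-1 _) = ℤ.∣ n ∣ , toℚᵘ-cancel-≤ (begin
    toℚᵘ q                   ≤⟨ ℚᵘ.*≤* (ℤ.≤-trans (ℤ.≤-reflexive (ℤ.*-identityʳ n)) (ℤ.≤-trans (n≤∣n∣ n) (ℤ.≤-trans (ℤ.≤-reflexive (sym (ℤ.*-identityʳ (ℤ.+ ℤ.∣ n ∣)))) (ℤ.*-monoˡ-≤-nonNeg (ℤ.+ ℤ.∣ n ∣) (ℤ.+≤+ (ℕ.s≤s ℕ.z≤n)))))) ⟩
    ℚᵘ.mkℚᵘ (ℤ.+ ℤ.∣ n ∣) 0    ≃⟨ toℚᵘ-ι ℤ.∣ n ∣ ⟨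
    toℚᵘ (ι ℤ.∣ n ∣)         ∎)
    where
    open ℚᵘ.≤-Reasoning
    n≤∣n∣ : ∀ i → i ℤ.≤ ℤ.+ ℤ.∣ i ∣
    n≤∣n∣ (ℤ.+ i)       = ℤ.≤-refl
    n≤∣n∣ ℤ.-[1+ i ] = ℤ.-≤+

  0<1 : 0ℚ < 1ℚ
  0<1 = positive⁻¹ 1ℚ

  *-monoˡ : ∀ {c a b} → 0ℚ ≤ c → a ≤ b → c * a ≤ c * b
  *-monoˡ {c} 0≤c = *-monoˡ-≤-nonNeg c {{nonNegative 0≤c}}

  *-monoʳ : ∀ {c a b} → 0ℚ ≤ c → a ≤ b → a * c ≤ b * c
  *-monoʳ {c} 0≤c = *-monoʳ-≤-nonNeg c {{nonNegative 0≤c}}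

  *-cancelʳ : ∀ {c a b} → 0ℚ < c → a * c ≤ b * c → a ≤ b
  *-cancelʳ {c} 0<c = *-cancelʳ-≤-pos c {{positive 0<c}}

  *-cancelˡ : ∀ {c a b} → 0ℚ < c → c * a ≤ c * b → a ≤ b
  *-cancelˡ {c} 0<c = *-cancelˡ-≤-pos c {{positive 0<c}}

  *-monoˡ-< : ∀ {c a b} → 0ℚ < c → a < b → c * a < c * b
  *-monoˡ-< {c} 0<c = *-monoʳ-<-pos c {{positive 0<c}}

  *-pos : ∀ {a b} → 0ℚ < a → 0ℚ < b → 0ℚ < a * b
  *-pos {a} {b} 0<a 0<b = subst (_< a * b) (*-zeroʳ a) (*-monoˡ-< 0<a 0<b)

  *-nonneg : ∀ {a b} → 0ℚ ≤ a → 0ℚ ≤ b → 0ℚ ≤ a * b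
  *-nonneg {a} {b} 0≤a 0≤b = subst (_≤ a * b) (*-zeroʳ a) (*-monoˡ 0≤a 0≤b)

  +-nonneg : ∀ {a b} → 0ℚ ≤ a → 0ℚ ≤ b → 0ℚ ≤ a + b
  +-nonneg = +-mono-≤

  -- Reciprocals are carried as witnesses of `a * b ≡ 1ℚ`: later steps are then ring identities for
  -- the solver, with the unit equation substituted where needed.
  recip : ∀ {a} → 0ℚ < a → ∃ λ b → 0ℚ < b × a * b ≡ 1ℚ
  recip {a} 0<a = quotient a 1ℚ (positive 0<a) 0<1

  ≤⇒0≤ : ∀ {a b} → a ≤ b → 0ℚ ≤ b - a
  ≤⇒0≤ {a} {b} a≤b = subst (_≤ b - a) (+-inverseʳ a) (+-monoˡ-≤ (- a) a≤b)

  <⇒0< : ∀ {a b} → a < b → 0ℚ < b - a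
  <⇒0< {a} {b} a<b = subst (_< b - a) (+-inverseʳ a) (+-monoˡ-< (- a) a<b)

  ≤-by : ∀ {a b e} → 0ℚ ≤ e → a + e ≡ b → a ≤ b
  ≤-by {a} {e = e} 0≤e refl = subst (_≤ a + e) (+-identityʳ a) (+-monoʳ-≤ a 0≤e)

  <-by : ∀ {a b e} → 0ℚ < e → a + e ≡ b → a < b
  <-by {a} {e = e} 0<e refl = subst (_< a + e) (+-identityʳ a) (+-monoʳ-< a 0<e)

  ∣∣-≤ : ∀ {a c} → a ≤ c → - a ≤ c → ∣ a ∣ ≤ c
  ∣∣-≤ {a} {c} p q with ∣p∣≡p∨∣p∣≡-p a
  ... | inj₁ eq = subst (_≤ c) (sym eq) p
  ... | inj₂ eq = subst (_≤ c) (sym eq) q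

  ≤∣∣ : ∀ a → a ≤ ∣ a ∣
  ≤∣∣ a with ≤-total 0ℚ a
  ... | inj₁ 0≤a = ≤-reflexive (sym (0≤p⇒∣p∣≡p 0≤a))
  ... | inj₂ a≤0 = ≤-trans a≤0 (0≤∣p∣ a)

  sum-mono-≤ : ∀ {n} {f g : Vector ℚ n} → (∀ i → f i ≤ g i) → sum f ≤ sum g
  sum-mono-≤ {zero}  _ = ≤-refl
  sum-mono-≤ {suc n} h = +-mono-≤ (h zero) (sum-mono-≤ (h ∘ suc))

  sum-nonneg : ∀ {n} {f : Vector ℚ n} → (∀ i → 0ℚ ≤ f i) → 0ℚ ≤ sum f
  sum-nonneg {zero}  _ = ≤-refl
  sum-nonneg {suc n} h = +-nonneg (h zero) (sum-nonneg (h ∘ suc))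

  sum-pos : ∀ {n} {f : Vector ℚ (suc n)} → (∀ i → 0ℚ < f i) → 0ℚ < sum f
  sum-pos h = +-mono-<-≤ (h zero) (sum-nonneg (<⇒≤ ∘ h ∘ suc))

  term≤sum : ∀ {n} {f : Vector ℚ n} → (∀ i → 0ℚ ≤ f i) → ∀ i → f i ≤ sum f
  term≤sum {suc n} h zero    = ≤-by (sum-nonneg (h ∘ suc)) refl
  term≤sum {suc n} {f} h (suc i) = ≤-trans (term≤sum (h ∘ suc) i) (≤-by (h zero) (+-comm _ (f zero)))

  δ : ∀ {n} → Fin n → Fin n → ℚ
  δ i j = if does (i Fin.≟ j) then 1ℚ else 0ℚ

  sum-zero : ∀ n → sum {n} (λ _ → 0ℚ) ≡ 0ℚ
  sum-zero zero    = refl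
  sum-zero (suc n) = trans (+-identityˡ _) (sum-zero n)

  δ-suc : ∀ {n} (i j : Fin n) → δ (suc i) (suc j) ≡ δ i j
  δ-suc i j with i Fin.≟ j
  ... | yes _ = refl
  ... | no _  = refl

  sum-δ : ∀ {n} i (w : Vector ℚ n) → sum (λ j → δ i j * w j) ≡ w i
  sum-δ {suc n} zero w = begin
    1ℚ * w zero + sum (λ j → 0ℚ * w (suc j))
      ≡⟨ cong₂ _+_ (*-identityˡ (w zero)) (trans (sum-cong-≗ (λ j → *-zeroˡ (w (suc j)))) (sum-zero n)) ⟩
    w zero + 0ℚ
      ≡⟨ +-identityʳ (w zero) ⟩
    w zero ∎
    where open ≡-Reasoning
  sum-δ {suc n} (suc i) w = begin
    0ℚ * w zero + sum (λ j → δ (suc i) (suc j) * w (suc j))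
      ≡⟨ cong₂ _+_ (*-zeroˡ (w zero)) (sum-cong-≗ (λ j → cong (_* w (suc j)) (δ-suc i j))) ⟩
    0ℚ + sum (λ j → δ i j * w (suc j))
      ≡⟨ trans (+-identityˡ _) (sum-δ i (w ∘ suc)) ⟩
    w (suc i) ∎
    where open ≡-Reasoning

  ratio-regroup : ∀ q r y → r * (q * y) ≡ q * r * y
  ratio-regroup = solve 3 (λ q r y → r :* (q :* y) := q :* r :* y) refl

  ratio-< : ∀ p r q y s → 0ℚ < r → q * r ≡ p → p * y < r * s → q * y < s
  ratio-< p r q y s 0<r eq h = *-cancelˡ-<-nonNeg r {{nonNegative (<⇒≤ 0<r)}}
    (subst (_< r * s) (sym (trans (ratio-regroup q r y) (cong (_* y) eq))) h)

  ratio-≤ : ∀ p r q y s → 0ℚ < r → q * r ≡ p → r * s ≤ p * y → s ≤ q * y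
  ratio-≤ p r q y s 0<r eq h = *-cancelˡ 0<r
    (subst (r * s ≤_) (sym (trans (ratio-regroup q r y) (cong (_* y) eq))) h)

  -- Contraction of ratio bounds by a positive matrix.

  contracted-width : ∀ K M l u y s h y⁻ → M ≡ K + 1ℚ → y⁻ ≡ - y → M * s * h ≡ 1ℚ →
    M * (- (- u + (y⁻ - (- u) * s) * h) - (l + (y - l * s) * h)) ≡ K * (u - l)
  contracted-width K M l u y s h _ M≡K+1 refl eq = begin
    M * (- (- u + (- y - (- u) * s) * h) - (l + (y - l * s) * h))
      ≡⟨ solve 6 (λ m u y s h l →
           m :* ((:- (:- u :+ (:- y :- (:- u) :* s) :* h)) :- (l :+ (y :- l :* s) :* h))
           := m :* (u :- l) :- (m :* s :* h) :* (u :- l)) refl M u y s h l ⟩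
    M * (u - l) - (M * s * h) * (u - l)
      ≡⟨ cong₂ (λ z z′ → z * (u - l) - z′ * (u - l)) M≡K+1 eq ⟩
    (K + 1ℚ) * (u - l) - 1ℚ * (u - l)
      ≡⟨ solve 2 (λ k w → (k :+ con 1ℚ) :* w :- con 1ℚ :* w := k :* w) refl K (u - l) ⟩
    K * (u - l) ∎
    where open ≡-Reasoning

  -- The width shrinks by K / (K + 1) while K + c grows by (K + c + 1) / (K + c),
  -- so their product never increases.
  width-step : ∀ K M w₁ w₂ c W → M ≡ K + 1ℚ → 0ℚ < M → 0ℚ ≤ w₁ → 0ℚ ≤ c →
    M * w₂ ≡ K * w₁ → w₁ * (K + c) ≤ K * W → w₂ * (K + (1ℚ + c)) ≤ K * W
  width-step K M w₁ w₂ c W M≡K+1 0<M 0≤w₁ 0≤c eq hyp = *-cancelˡ 0<M (begin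
    M * (w₂ * (K + (1ℚ + c)))   ≡⟨ *-assoc M w₂ (K + (1ℚ + c)) ⟨
    M * w₂ * (K + (1ℚ + c))     ≡⟨ cong (_* (K + (1ℚ + c))) eq ⟩
    K * w₁ * (K + (1ℚ + c))
      ≤⟨ ≤-by {K * w₁ * (K + (1ℚ + c))} {(K + 1ℚ) * (w₁ * (K + c))} (*-nonneg 0≤w₁ 0≤c)
         (solve 3 (λ k w c → k :* w :* (k :+ (con 1ℚ :+ c)) :+ w :* c
                    := (k :+ con 1ℚ) :* (w :* (k :+ c))) refl K w₁ c) ⟩
    (K + 1ℚ) * (w₁ * (K + c))   ≡⟨ cong (_* (w₁ * (K + c))) M≡K+1 ⟨
    M * (w₁ * (K + c))          ≤⟨ *-monoˡ (<⇒≤ 0<M) hyp ⟩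
    M * (K * W)                 ∎)
    where open ≤-Reasoning

  module PositiveMatrix {n} (B : Fin (suc n) → Fin (suc n) → ℚ) (K M : ℚ)
    (0<K : 0ℚ < K) (M≡K+1 : M ≡ K + 1ℚ)
    (1≤B : ∀ i j → 1ℚ ≤ B i j) (B≤M : ∀ i j → B i j ≤ M) where

    0<M : 0ℚ < M
    0<M = subst (0ℚ <_) (sym M≡K+1) (+-mono-< 0<K 0<1)

    0≤B : ∀ i j → 0ℚ ≤ B i j
    0≤B i j = ≤-trans (<⇒≤ 0<1) (1≤B i j)

    Vec : Set
    Vec = Vector ℚ (suc n)

    apply : Vec → Vec
    apply v i = sum (λ j → B i j * v j)

    apply-mono : ∀ {v w} → (∀ j → v j ≤ w j) → ∀ i → apply v i ≤ apply w i
    apply-mono h i = sum-mono-≤ (λ j → *-monoˡ (0≤B i j) (h j))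

    apply-scale : ∀ c v i → apply (λ j → c * v j) i ≡ c * apply v i
    apply-scale c v i = trans
      (sum-cong-≗ (λ j → solve 3 (λ b c v → b :* (c :* v) := c :* (b :* v)) refl (B i j) c (v j)))
      (sym (*-distribˡ-sum c (λ j → B i j * v j)))

    apply-+ : ∀ v w i → apply (λ j → v j + w j) i ≡ apply v i + apply w i
    apply-+ v w i = trans (sum-cong-≗ (λ j → *-distribˡ-+ (B i j) (v j) (w j)))
      (∑-distrib-+ (λ j → B i j * v j) (λ j → B i j * w j))

    sum≤apply : ∀ {v} → (∀ j → 0ℚ ≤ v j) → ∀ i → sum v ≤ apply v i
    sum≤apply {v} h i = sum-mono-≤ (λ j → subst (_≤ B i j * v j) (*-identityˡ (v j)) (*-monoʳ (h j) (1≤B i j)))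

    apply≤sum : ∀ {v} → (∀ j → 0ℚ ≤ v j) → ∀ i → apply v i ≤ M * sum v
    apply≤sum {v} h i = subst (apply v i ≤_) (sym (*-distribˡ-sum M v))
      (sum-mono-≤ (λ j → *-monoʳ (h j) (B≤M i j)))

    apply-pos : ∀ {v} → (∀ j → 0ℚ < v j) → ∀ i → 0ℚ < apply v i
    apply-pos h i = <-≤-trans (sum-pos h) (sum≤apply (<⇒≤ ∘ h) i)

    apply-spread : ∀ {v} → (∀ j → 0ℚ ≤ v j) → ∀ i j → apply v i ≤ M * apply v j
    apply-spread h i j = ≤-trans (apply≤sum h i) (*-monoˡ (<⇒≤ 0<M) (sum≤apply h j))

    record Between (l u : ℚ) (v y : Vec) : Set where
      constructor between
      field
        lower : ∀ i → l * v i ≤ y i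
        upper : ∀ i → y i ≤ u * v i

    open Between

    between-≤ : ∀ {l u v y} → (∀ i → 0ℚ < v i) → Between l u v y → l ≤ u
    between-≤ v>0 b = *-cancelʳ (v>0 zero) (≤-trans (lower b zero) (upper b zero))

    apply-slack : ∀ l v y → (∀ i → l * v i ≤ y i) → ∀ i →
                  l * apply v i + (sum y - l * sum v) ≤ apply y i
    apply-slack l v y h i = subst₂ _≤_ (cong (l * apply v i +_) sum-e) apply-y
      (+-monoʳ-≤ (l * apply v i) (sum≤apply (λ j → ≤⇒0≤ (h j)) i))
      where
      open ≡-Reasoning
      e : Vec
      e j = y j - l * v j
      split : ∀ a b → a ≡ b + (a - b)
      split = solve 2 (λ a b → a := b :+ (a :- b)) refl
      sum-y : sum y ≡ l * sum v + sum e
      sum-y = begin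
        sum y                             ≡⟨ sum-cong-≗ (λ j → split (y j) (l * v j)) ⟩
        sum (λ j → l * v j + e j)         ≡⟨ ∑-distrib-+ (λ j → l * v j) e ⟩
        sum (λ j → l * v j) + sum e       ≡⟨ cong (_+ sum e) (*-distribˡ-sum l v) ⟨
        l * sum v + sum e                 ∎
      sum-e : sum e ≡ sum y - l * sum v
      sum-e = trans (solve 2 (λ a b → a := (b :+ a) :- b) refl (sum e) (l * sum v))
        (cong (_- l * sum v) (sym sum-y))
      apply-y : l * apply v i + apply e i ≡ apply y i
      apply-y = begin
        l * apply v i + apply e i            ≡⟨ cong (_+ apply e i) (apply-scale l v i) ⟨
        apply (λ j → l * v j) i + apply e i  ≡⟨ apply-+ (λ j → l * v j) e i ⟨
        apply (λ j → l * v j + e j) i        ≡⟨ sum-cong-≗ (λ j → cong (B i j *_) (sym (split (y j) (l * v j)))) ⟩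
        apply y i                            ∎

    -- The slack of the lower bound, summed over all coordinates, is spread over
    -- every coordinate by B ≥ 1, while B ≤ M bounds what it is compared with.
    raise : ∀ l v y {h} → (∀ i → 0ℚ < v i) → 0ℚ < h → M * sum v * h ≡ 1ℚ → (∀ i → l * v i ≤ y i) →
            ∀ i → (l + (sum y - l * sum v) * h) * apply v i ≤ apply y i
    raise l v y {h} v>0 h>0 eq hyp i = begin
      (l + s * h) * apply v i              ≡⟨ *-distribʳ-+ (apply v i) l (s * h) ⟩
      l * apply v i + s * h * apply v i    ≤⟨ +-monoʳ-≤ (l * apply v i) (*-monoˡ (*-nonneg 0≤s (<⇒≤ h>0)) (apply≤sum (<⇒≤ ∘ v>0) i)) ⟩
      l * apply v i + s * h * (M * sum v)  ≡⟨ cong (l * apply v i +_) unit ⟩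
      l * apply v i + s                    ≤⟨ apply-slack l v y hyp i ⟩
      apply y i                            ∎
      where
      open ≤-Reasoning
      s = sum y - l * sum v
      0≤s : 0ℚ ≤ s
      0≤s = ≤⇒0≤ (subst (_≤ sum y) (sym (*-distribˡ-sum l v)) (sum-mono-≤ hyp))
      unit : s * h * (M * sum v) ≡ s
      unit = trans (solve 3 (λ s h m → s :* h :* m := s :* (m :* h)) refl s h (M * sum v))
        (trans (cong (s *_) eq) (*-identityʳ s))

    neg-sum : ∀ (v : Vec) → sum (λ j → - v j) ≡ - sum v
    neg-sum v = begin
      sum (λ j → - v j)        ≡⟨ sum-cong-≗ (λ j → solve 1 (λ a → :- a := con (- 1ℚ) :* a) refl (v j)) ⟩
      sum (λ j → - 1ℚ * v j)   ≡⟨ *-distribˡ-sum (- 1ℚ) v ⟨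
      - 1ℚ * sum v             ≡⟨ solve 1 (λ a → con (- 1ℚ) :* a := :- a) refl (sum v) ⟩
      - sum v                  ∎
      where open ≡-Reasoning

    neg-apply : ∀ v i → apply (λ j → - v j) i ≡ - apply v i
    neg-apply v i = begin
      apply (λ j → - v j) i      ≡⟨ sum-cong-≗ (λ j → cong (B i j *_) (solve 1 (λ a → :- a := con (- 1ℚ) :* a) refl (v j))) ⟩
      apply (λ j → - 1ℚ * v j) i ≡⟨ apply-scale (- 1ℚ) v i ⟩
      - 1ℚ * apply v i           ≡⟨ solve 1 (λ a → con (- 1ℚ) :* a := :- a) refl (apply v i) ⟩
      - apply v i                ∎
      where open ≡-Reasoning

    -- An upper bound for `y` is a lower bound for `- y` with constant `- u`, so `raise` serves both
    -- ends. The two gains add up to `(u - l) * sum v * h`, in which `sum y` has cancelled; since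
    -- `sum v * h` is 1 / M, the width shrinks by exactly K / M.
    contract : ∀ {l u v y} → (∀ i → 0ℚ < v i) → Between l u v y →
               ∃₂ λ l′ u′ → l ≤ l′ × Between l′ u′ (apply v) (apply y) × M * (u′ - l′) ≡ K * (u - l)
    contract {l} {u} {v} {y} v>0 b =
      l + (sum y - l * sum v) * h , - u′ ,
      ≤-by (*-nonneg (≤⇒0≤ (subst (_≤ sum y) (sym (*-distribˡ-sum l v)) (sum-mono-≤ (lower b)))) (<⇒≤ h>0)) refl ,
      between (raise l v y v>0 h>0 eq (lower b)) up , width
      where
      unit = recip (*-pos 0<M (sum-pos v>0))
      h = proj₁ unit
      h>0 = proj₁ (proj₂ unit)
      eq = proj₂ (proj₂ unit)
      u′ = - u + (sum (λ j → - y j) - (- u) * sum v) * h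
      up : ∀ i → apply y i ≤ - u′ * apply v i
      up i = begin
        apply y i               ≡⟨ solve 1 (λ a → a := :- (:- a)) refl (apply y i) ⟩
        - (- apply y i)         ≡⟨ cong -_ (neg-apply y i) ⟨
        - apply (λ j → - y j) i ≤⟨ neg-antimono-≤ (raise (- u) v (λ j → - y j) v>0 h>0 eq (λ j → begin
             - u * v j     ≡⟨ neg-distribˡ-* u (v j) ⟨
             - (u * v j)   ≤⟨ neg-antimono-≤ (upper b j) ⟩
             - y j         ∎) i) ⟩
        - (u′ * apply v i)      ≡⟨ neg-distribˡ-* u′ (apply v i) ⟩
        - u′ * apply v i        ∎
        where open ≤-Reasoning
      width : M * (- u′ - (l + (sum y - l * sum v) * h)) ≡ K * (u - l)
      width = contracted-width K M l u (sum y) (sum v) h (sum (λ j → - y j)) M≡K+1 (neg-sum y) eq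

    iterate : ℕ → Vec → Vec
    iterate zero    v = v
    iterate (suc k) v = apply (iterate k v)

    iterate-+ : ∀ k m v → iterate (k ℕ.+ m) v ≡ iterate k (iterate m v)
    iterate-+ zero    m v = refl
    iterate-+ (suc k) m v = cong apply (iterate-+ k m v)

    iterate-pos : ∀ k {v} → (∀ i → 0ℚ < v i) → ∀ i → 0ℚ < iterate k v i
    iterate-pos zero    v>0 = v>0
    iterate-pos (suc k) v>0 = apply-pos (iterate-pos k v>0)

    -- The decay is geometric, but only the weaker bound K / (K + k) is recorded: it involves no
    -- powers, and the Archimedean property alone makes it small. `l ≤ l′` is kept so that errors
    -- can be measured against the initial lower bound.
    contract-iterate : ∀ k {l u v y} → (∀ i → 0ℚ < v i) → Between l u v y →
      ∃₂ λ l′ u′ → l ≤ l′ × Between l′ u′ (iterate k v) (iterate k y) ×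
                   (u′ - l′) * (K + ι k) ≤ K * (u - l)
    contract-iterate zero {l} {u} v>0 b = l , u , ≤-refl , b ,
      ≤-reflexive (solve 2 (λ k w → w :* (k :+ con 0ℚ) := k :* w) refl K (u - l))
    contract-iterate (suc k) {l} {u} {v} {y} v>0 b =
      let l₁ , u₁ , l≤l₁ , b₁ , w₁ = contract-iterate k v>0 b
          l₂ , u₂ , l₁≤l₂ , b₂ , w₂ = contract (iterate-pos k v>0) b₁
      in l₂ , u₂ , ≤-trans l≤l₁ l₁≤l₂ , b₂ ,
        subst (λ c → (u₂ - l₂) * (K + c) ≤ K * (u - l)) (sym (ι-+ 1 k))
          (width-step K M (u₁ - l₁) (u₂ - l₂) (ι k) (u - l) M≡K+1 0<M
            (≤⇒0≤ (between-≤ (iterate-pos k v>0) b₁)) (ι-nonneg k) w₂ w₁)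

  -- Convergence of the normalised iterates.

  ratio-close : ∀ l u a b P {y₀ v₀ yᵢ vᵢ} → 0ℚ < y₀ → 0ℚ < v₀ → 0ℚ ≤ l → l ≤ u → 0ℚ ≤ b →
    yᵢ ≡ a * y₀ → vᵢ ≡ b * v₀ → l * v₀ ≤ y₀ → y₀ ≤ u * v₀ → l * vᵢ ≤ yᵢ → yᵢ ≤ u * vᵢ →
    0ℚ ≤ a → a ≤ P → b ≤ P → l * ∣ a - b ∣ ≤ (u - l) * P
  ratio-close l u a b P {y₀} {v₀} y₀>0 v₀>0 0≤l l≤u 0≤b refl refl l₀ u₀ lᵢ uᵢ 0≤a a≤P b≤P =
    subst (_≤ (u - l) * P) abs (∣∣-≤ upper lower)
    where
    open ≤-Reasoning
    0≤u = ≤-trans 0≤l l≤u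
    -- `a` and `b` are the ratios of coordinate i to the base coordinate. The upper bound at i with
    -- the lower bound at the base gives `l * a ≤ u * b`; the other two bounds give `l * b ≤ u * a`.
    la≤ub : l * a ≤ u * b
    la≤ub = *-cancelʳ y₀>0 (begin
      l * a * y₀        ≡⟨ *-assoc l a y₀ ⟩
      l * (a * y₀)      ≤⟨ *-monoˡ 0≤l uᵢ ⟩
      l * (u * (b * v₀)) ≡⟨ solve 4 (λ l u b v → l :* (u :* (b :* v)) := u :* b :* (l :* v)) refl l u b v₀ ⟩
      u * b * (l * v₀)  ≤⟨ *-monoˡ (*-nonneg 0≤u 0≤b) l₀ ⟩
      u * b * y₀        ∎)
    lb≤ua : l * b ≤ u * a
    lb≤ua = *-cancelʳ v₀>0 (begin
      l * b * v₀        ≡⟨ *-assoc l b v₀ ⟩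
      l * (b * v₀)      ≤⟨ lᵢ ⟩
      a * y₀            ≤⟨ *-monoˡ 0≤a u₀ ⟩
      a * (u * v₀)      ≡⟨ solve 3 (λ a u v → a :* (u :* v) := u :* a :* v) refl a u v₀ ⟩
      u * a * v₀        ∎)
    gap : ∀ p q → l * p ≤ u * q → q ≤ P → l * (p - q) ≤ (u - l) * P
    gap p q lp≤uq q≤P = begin
      l * (p - q)       ≡⟨ solve 3 (λ l p q → l :* (p :- q) := l :* p :- l :* q) refl l p q ⟩
      l * p - l * q     ≤⟨ +-monoˡ-≤ (- (l * q)) lp≤uq ⟩
      u * q - l * q     ≡⟨ solve 3 (λ l u q → u :* q :- l :* q := (u :- l) :* q) refl l u q ⟩
      (u - l) * q       ≤⟨ *-monoˡ (≤⇒0≤ l≤u) q≤P ⟩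
      (u - l) * P       ∎
    upper : l * (a - b) ≤ (u - l) * P
    upper = gap a b la≤ub b≤P
    lower : - (l * (a - b)) ≤ (u - l) * P
    lower = subst (_≤ (u - l) * P)
      (solve 3 (λ l a b → l :* (b :- a) := :- (l :* (a :- b))) refl l a b) (gap b a lb≤ua a≤P)
    abs : ∣ l * (a - b) ∣ ≡ l * ∣ a - b ∣
    abs = trans (∣p*q∣≡∣p∣*∣q∣ l (a - b)) (cong (_* ∣ a - b ∣) (0≤p⇒∣p∣≡p 0≤l))

  -- The initial width is measured in units of the initial lower bound, `W₀ ≤ l₀ * Q`. Lower bounds
  -- only increase, so `l` cancels and the final estimate is free of `l` and of the widths.
  close-bound : ∀ l l₀ W W₀ d K P Q c → 0ℚ ≤ K → 0ℚ ≤ c → 0ℚ < l → l₀ ≤ l → 0ℚ ≤ d → 0ℚ ≤ P → 0ℚ ≤ Q →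
    l * d ≤ W * P → W * (K + c) ≤ K * W₀ → W₀ ≤ l₀ * Q → d * c ≤ K * Q * P
  close-bound l l₀ W W₀ d K P Q c 0≤K 0≤c 0<l l₀≤l 0≤d 0≤P 0≤Q ld≤WP WKc≤KW₀ W₀≤l₀Q = *-cancelˡ 0<l (begin
    l * (d * c)             ≤⟨ ≤-by {l * (d * c)} {l * d * (K + c)} (*-nonneg (*-nonneg (<⇒≤ 0<l) 0≤d) 0≤K)
                                 (solve 4 (λ l d c k → l :* (d :* c) :+ l :* d :* k := l :* d :* (k :+ c)) refl l d c K) ⟩
    l * d * (K + c)         ≤⟨ *-monoʳ (+-nonneg 0≤K 0≤c) ld≤WP ⟩
    W * P * (K + c)         ≡⟨ solve 3 (λ w p k → w :* p :* k := w :* k :* p) refl W P (K + c) ⟩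
    W * (K + c) * P         ≤⟨ *-monoʳ 0≤P WKc≤KW₀ ⟩
    K * W₀ * P              ≤⟨ *-monoʳ 0≤P (*-monoˡ 0≤K (≤-trans W₀≤l₀Q (*-monoʳ 0≤Q l₀≤l))) ⟩
    K * (l * Q) * P         ≡⟨ solve 4 (λ k l q p → k :* (l :* q) :* p := l :* (k :* q :* p)) refl K l Q P ⟩
    l * (K * Q * P)         ∎)
    where open ≤-Reasoning

  -- All late terms are compared with one anchor, `s (k + 1)`, at half the tolerance, with `k`
  -- chosen so that `C < h * ι k`. The shift by one reflects that iterates are under control only
  -- after one application of the matrix.
  cauchy-by : ∀ (s : ℕ → ℚ) C → (∀ k j → ∣ s (k ℕ.+ suc j) - s (k ℕ.+ 1) ∣ * ι k ≤ C) → Cauchy s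
  cauchy-by s C close ε 0<ε = suc k , λ m n m≥ n≥ → ε-close m n (tail m m≥) (tail n n≥)
    where
    open ≤-Reasoning
    half = quotient (1ℚ + 1ℚ) ε (positive (+-mono-< 0<1 0<1)) 0<ε
    h = proj₁ half
    0<h = proj₁ (proj₂ half)
    unit = recip 0<h
    big = archimedean (C * proj₁ unit)
    k = suc (proj₁ big)
    C<hk : C < h * ι k
    C<hk = begin-strict
      C                       ≡⟨ *-identityˡ C ⟨
      1ℚ * C                  ≡⟨ cong (_* C) (proj₂ (proj₂ unit)) ⟨
      h * proj₁ unit * C      ≡⟨ solve 3 (λ h u c → h :* u :* c := h :* (c :* u)) refl h (proj₁ unit) C ⟩
      h * (C * proj₁ unit)    <⟨ *-monoˡ-< 0<h (≤-<-trans (proj₂ big) (ι-mono-< {proj₁ big} (ℕ.n<1+n (proj₁ big)))) ⟩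
      h * ι k                 ∎
    tail : ∀ m → suc k ℕ.≤ m → ∣ s m - s (k ℕ.+ 1) ∣ < h
    tail m k<m = *-cancelʳ-<-nonNeg (ι k) {{nonNegative (ι-nonneg k)}}
      (≤-<-trans (subst (λ z → ∣ s z - s (k ℕ.+ 1) ∣ * ι k ≤ C) index (close k (m ℕ.∸ suc k))) C<hk)
      where
      index : k ℕ.+ suc (m ℕ.∸ suc k) ≡ m
      index = trans (ℕ.+-suc k (m ℕ.∸ suc k)) (ℕ.m+[n∸m]≡n k<m)
    ε-close : ∀ m n → ∣ s m - s (k ℕ.+ 1) ∣ < h → ∣ s n - s (k ℕ.+ 1) ∣ < h → ∣ s m - s n ∣ < ε
    ε-close m n p q = begin-strict
      ∣ s m - s n ∣
        ≡⟨ cong ∣_∣ (solve 3 (λ a b c → a :- b := (a :- c) :- (b :- c)) refl (s m) (s n) (s (k ℕ.+ 1))) ⟩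
      ∣ (s m - s (k ℕ.+ 1)) - (s n - s (k ℕ.+ 1)) ∣
        ≤⟨ ∣p-q∣≤∣p∣+∣q∣ (s m - s (k ℕ.+ 1)) (s n - s (k ℕ.+ 1)) ⟩
      ∣ s m - s (k ℕ.+ 1) ∣ + ∣ s n - s (k ℕ.+ 1) ∣
        <⟨ +-mono-< p q ⟩
      h + h
        ≡⟨ solve 1 (λ h → h :+ h := (con 1ℚ :+ con 1ℚ) :* h) refl h ⟩
      (1ℚ + 1ℚ) * h
        ≡⟨ proj₂ (proj₂ half) ⟩
      ε ∎

  module Iterates {n} (B : Fin (suc n) → Fin (suc n) → ℚ) (K M : ℚ)
    (0<K : 0ℚ < K) (M≡K+1 : M ≡ K + 1ℚ)
    (1≤B : ∀ i j → 1ℚ ≤ B i j) (B≤M : ∀ i j → B i j ≤ M)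
    (w : Vector ℚ (suc n)) (w>0 : ∀ i → 0ℚ < w i) where

    open PositiveMatrix B K M 0<K M≡K+1 1≤B B≤M public

    v : ℕ → Vec
    v m = iterate m w

    v>0 : ∀ m i → 0ℚ < v m i
    v>0 m = iterate-pos m w>0

    v-spread : ∀ m i j → v (suc m) i ≤ M * v (suc m) j
    v-spread m i j = apply-spread (<⇒≤ ∘ v>0 m) i j

    Q : ℚ
    Q = M * M * (M * M)

    0≤Q : 0ℚ ≤ Q
    0≤Q = <⇒≤ (*-pos (*-pos 0<M 0<M) (*-pos 0<M 0<M))

    -- The spread hypotheses hold after one application of the matrix. Passing through the base
    -- coordinates then costs a factor M for each of the two vectors, at both ends, so u / l is the
    -- fourth power of M. That `Q` is the same for all pairs makes the Cauchy rate uniform.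
    comparable : ∀ {v y} → (∀ i → 0ℚ < v i) → (∀ i → 0ℚ < y i) →
      (∀ i j → v i ≤ M * v j) → (∀ i j → y i ≤ M * y j) →
      ∃₂ λ l u → 0ℚ < l × Between l u v y × u ≡ l * Q
    comparable {v} {y} v>0 y>0 v-spr y-spr = l , u , 0<l , between lo up , u≡
      where
      open ≤-Reasoning
      rM = recip 0<M
      m = proj₁ rM
      0<m = proj₁ (proj₂ rM)
      Mm≡1 : M * m ≡ 1ℚ
      Mm≡1 = proj₂ (proj₂ rM)
      rv = recip (v>0 zero)
      c = y zero * proj₁ rv
      0<c : 0ℚ < c
      0<c = *-pos (y>0 zero) (proj₁ (proj₂ rv))
      cv≡y : c * v zero ≡ y zero
      cv≡y = trans (solve 3 (λ y r v → y :* r :* v := y :* (v :* r)) refl (y zero) (proj₁ rv) (v zero))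
        (trans (cong (y zero *_) (proj₂ (proj₂ rv))) (*-identityʳ (y zero)))
      l = c * (m * m)
      u = c * (M * M)
      0<l : 0ℚ < l
      0<l = *-pos 0<c (*-pos 0<m 0<m)
      lo : ∀ i → l * v i ≤ y i
      lo i = begin
        c * (m * m) * v i            ≤⟨ *-monoˡ (<⇒≤ 0<l) (v-spr i zero) ⟩
        c * (m * m) * (M * v zero)   ≡⟨ solve 4 (λ c m M v → c :* (m :* m) :* (M :* v) := M :* m :* (m :* (c :* v))) refl c m M (v zero) ⟩
        M * m * (m * (c * v zero))   ≡⟨ cong₂ (λ a b → a * (m * b)) Mm≡1 cv≡y ⟩
        1ℚ * (m * y zero)            ≡⟨ *-identityˡ (m * y zero) ⟩
        m * y zero                   ≤⟨ *-monoˡ (<⇒≤ 0<m) (y-spr zero i) ⟩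
        m * (M * y i)                ≡⟨ solve 3 (λ m M y → m :* (M :* y) := M :* m :* y) refl m M (y i) ⟩
        M * m * y i                  ≡⟨ cong (_* y i) Mm≡1 ⟩
        1ℚ * y i                     ≡⟨ *-identityˡ (y i) ⟩
        y i                          ∎
      up : ∀ i → y i ≤ u * v i
      up i = begin
        y i                    ≤⟨ y-spr i zero ⟩
        M * y zero             ≡⟨ cong (M *_) cv≡y ⟨
        M * (c * v zero)       ≤⟨ *-monoˡ (<⇒≤ 0<M) (*-monoˡ (<⇒≤ 0<c) (v-spr zero i)) ⟩
        M * (c * (M * v i))    ≡⟨ solve 3 (λ M c v → M :* (c :* (M :* v)) := c :* (M :* M) :* v) refl M c (v i) ⟩
        c * (M * M) * v i      ∎
      u≡ : u ≡ l * Q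
      u≡ = begin-equality
        c * (M * M)                          ≡⟨ solve 2 (λ c M → c :* (M :* M) := con 1ℚ :* con 1ℚ :* (c :* (M :* M))) refl c M ⟩
        1ℚ * 1ℚ * (c * (M * M))              ≡⟨ cong (λ z → z * z * (c * (M * M))) Mm≡1 ⟨
        M * m * (M * m) * (c * (M * M))      ≡⟨ solve 3 (λ c M m → M :* m :* (M :* m) :* (c :* (M :* M)) := c :* (m :* m) :* (M :* M :* (M :* M))) refl c M m ⟩
        c * (m * m) * (M * M * (M * M))      ∎

    scale : ℕ → ℚ
    scale m = proj₁ (recip (v>0 m zero))

    scale>0 : ∀ m → 0ℚ < scale m
    scale>0 m = proj₁ (proj₂ (recip (v>0 m zero)))

    scale-inv : ∀ m → v m zero * scale m ≡ 1ℚ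
    scale-inv m = proj₂ (proj₂ (recip (v>0 m zero)))

    x : ℕ → Vec
    x m i = v m i * scale m

    x-scale : ∀ m i → v m i ≡ x m i * v m zero
    x-scale m i = sym (trans
      (solve 3 (λ v s z → v :* s :* z := v :* (z :* s)) refl (v m i) (scale m) (v m zero))
      (trans (cong (v m i *_) (scale-inv m)) (*-identityʳ (v m i))))

    x≥0 : ∀ m i → 0ℚ ≤ x m i
    x≥0 m i = <⇒≤ (*-pos (v>0 m i) (scale>0 m))

    x≤M : ∀ m i → x (suc m) i ≤ M
    x≤M m i = *-cancelʳ (v>0 (suc m) zero) (subst (_≤ M * v (suc m) zero) (x-scale (suc m) i) (v-spread m i zero))

    x-close : ∀ i k j → ∣ x (k ℕ.+ suc j) i - x (k ℕ.+ 1) i ∣ * ι k ≤ K * Q * M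
    x-close i k j =
      -- The two iterates are `k` further steps from `v 1` and from `v (suc j)`, so the initial
      -- comparison is between these two.
      let l₀ , u₀ , 0<l₀ , b₀ , u₀≡ = comparable (v>0 1) (v>0 (suc j)) (v-spread 0) (v-spread j)
          l , u , l₀≤l , b , width = contract-iterate k (v>0 1) b₀
          b′ = subst₂ (Between l u) (sym (iterate-+ k 1 w)) (sym (iterate-+ k (suc j) w)) b
          p = k ℕ.+ 1
          q = k ℕ.+ suc j
          0<l = <-≤-trans 0<l₀ l₀≤l
      in close-bound l l₀ (u - l) (u₀ - l₀) ∣ x q i - x p i ∣ K M Q (ι k)
           (<⇒≤ 0<K) (ι-nonneg k) 0<l l₀≤l (0≤∣p∣ (x q i - x p i)) (<⇒≤ 0<M) 0≤Q
           (ratio-close l u (x q i) (x p i) M (v>0 q zero) (v>0 p zero) (<⇒≤ 0<l)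
             (between-≤ (v>0 p) b′) (x≥0 p i) (x-scale q i) (x-scale p i)
             (Between.lower b′ zero) (Between.upper b′ zero) (Between.lower b′ i) (Between.upper b′ i)
             (x≥0 q i) (subst (λ z → x z i ≤ M) (sym (ℕ.+-suc k j)) (x≤M (k ℕ.+ j) i))
             (subst (λ z → x z i ≤ M) (sym (ℕ.+-suc k 0)) (x≤M (k ℕ.+ 0) i)))
           width
           (≤-trans (≤-by {u₀ - l₀} {u₀} (<⇒≤ 0<l₀) (solve 2 (λ u l → u :- l :+ l := u) refl u₀ l₀)) (≤-reflexive u₀≡))

    x-cauchy : ∀ i → Cauchy (λ m → x m i)
    x-cauchy i = cauchy-by (λ m → x m i) (K * Q * M) (x-close i)

  -- Finite extrema, joint thresholds and sums of reals.

  maximiser : ∀ {n} (f : Vector ℚ (suc n)) → ∃ λ i → ∀ j → f j ≤ f i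
  maximiser {zero}  f = zero , λ { zero → ≤-refl }
  maximiser {suc n} f with i , h ← maximiser (f ∘ suc) | ≤-total (f zero) (f (suc i))
  ... | inj₁ p = suc i , λ { zero → p ; (suc j) → h j }
  ... | inj₂ p = zero , λ { zero → ≤-refl ; (suc j) → ≤-trans (h j) p }

  positive-lower-bound : ∀ {n} (f : Vector ℚ (suc n)) → (∀ i → 0ℚ < f i) →
                         ∃ λ c → 0ℚ < c × (∀ i → c ≤ f i)
  positive-lower-bound {zero}  f f>0 = f zero , f>0 zero , λ { zero → ≤-refl }
  positive-lower-bound {suc n} f f>0 with c , c>0 , h ← positive-lower-bound (f ∘ suc) (f>0 ∘ suc) | ≤-total (f zero) c
  ... | inj₁ p = f zero , f>0 zero , λ { zero → ≤-refl ; (suc j) → ≤-trans p (h j) }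
  ... | inj₂ p = c , c>0 , λ { zero → p ; (suc j) → h j }

  eventually-all : ∀ {n} {P : Fin n → ℕ → Set} → (∀ i → ∃ λ N → ∀ m → N ℕ.≤ m → P i m) →
                   ∃ λ N → ∀ m → N ℕ.≤ m → ∀ i → P i m
  eventually-all {zero}  h = 0 , λ _ _ ()
  eventually-all {suc n} h =
    let N , hN = h zero
        N′ , hN′ = eventually-all (h ∘ suc)
    in N ℕ.⊔ N′ , λ { m p zero    → hN m (ℕ.m⊔n≤o⇒m≤o N N′ p)
                    ; m p (suc i) → hN′ m (ℕ.m⊔n≤o⇒n≤o N N′ p) i }

  ∣sum∣≤ : ∀ {n} (f : Vector ℚ n) → ∣ sum f ∣ ≤ sum (λ i → ∣ f i ∣)
  ∣sum∣≤ {zero}  f = ≤-refl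
  ∣sum∣≤ {suc n} f = ≤-trans (∣p+q∣≤∣p∣+∣q∣ (f zero) (sum (f ∘ suc)))
    (+-monoʳ-≤ ∣ f zero ∣ (∣sum∣≤ (f ∘ suc)))

  seq-∑ : ∀ {n} (f : Vector ℝ n) m → seq (∑ f) m ≡ sum (λ i → seq (f i) m)
  seq-∑ {zero}  f m = refl
  seq-∑ {suc n} f m = cong (seq (f zero) m +_) (seq-∑ (f ∘ suc) m)

  infixr 8 _·_

  _·_ : ∀ {m n} → (Fin m → Fin n → ℚ) → Vector ℚ n → Vector ℚ m
  (A · v) i = sum (λ j → A i j * v j)

  real : ∀ {m n} → (Fin m → Fin n → ℚ) → Fin m → Fin n → ℝ
  real A i j = fromℚ (A i j)

  -- The Perron eigenpair as Cauchy sequences.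

  module Perron {n} (A : Fin (suc n) → Fin (suc n) → ℚ) (K M : ℚ)
    (0<K : 0ℚ < K) (M≡K+1 : M ≡ K + 1ℚ) (0≤A : ∀ i j → 0ℚ ≤ A i j)
    (1≤A : ∀ i j → i ≢ j → 1ℚ ≤ A i j) (A≤K : ∀ i j → A i j ≤ K)
    (w : Vector ℚ (suc n)) (w>0 : ∀ i → 0ℚ < w i) where

    B : Fin (suc n) → Fin (suc n) → ℚ
    B i j = A i j + δ i j

    1≤B : ∀ i j → 1ℚ ≤ B i j
    1≤B i j with i Fin.≟ j
    ... | yes _  = ≤-by (0≤A i j) (+-comm 1ℚ (A i j))
    ... | no i≢j = subst (1ℚ ≤_) (sym (+-identityʳ (A i j))) (1≤A i j i≢j)

    B≤M : ∀ i j → B i j ≤ M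
    B≤M i j = subst (B i j ≤_) (sym M≡K+1) (bound i j)
      where
      bound : ∀ i j → B i j ≤ K + 1ℚ
      bound i j with i Fin.≟ j
      ... | yes _ = +-monoˡ-≤ 1ℚ (A≤K i j)
      ... | no _  = +-mono-≤ (A≤K i j) (<⇒≤ 0<1)

    open Iterates B K M 0<K M≡K+1 1≤B B≤M w w>0 public

    apply-A : ∀ v i → apply v i ≡ (A · v) i + v i
    apply-A v i = begin
      sum (λ j → B i j * v j)
        ≡⟨ sum-cong-≗ (λ j → *-distribʳ-+ (v j) (A i j) (δ i j)) ⟩
      sum (λ j → A i j * v j + δ i j * v j)
        ≡⟨ ∑-distrib-+ (λ j → A i j * v j) (λ j → δ i j * v j) ⟩
      sum (λ j → A i j * v j) + sum (λ j → δ i j * v j)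
        ≡⟨ cong (sum (λ j → A i j * v j) +_) (sum-δ i v) ⟩
      sum (λ j → A i j * v j) + v i ∎
      where open ≡-Reasoning

    x₀≡1 : ∀ m → x m zero ≡ 1ℚ
    x₀≡1 m = scale-inv m

    apply-x : ∀ m i → apply (x m) i ≡ v (suc m) i * scale m
    apply-x m i = begin
      apply (x m) i                      ≡⟨ sum-cong-≗ (λ j → cong (B i j *_) (*-comm (v m j) (scale m))) ⟩
      apply (λ j → scale m * v m j) i    ≡⟨ apply-scale (scale m) (v m) i ⟩
      scale m * v (suc m) i              ≡⟨ *-comm (scale m) (v (suc m) i) ⟩
      v (suc m) i * scale m              ∎
      where open ≡-Reasoning

    ratio : ∀ m → v (suc m) zero * scale m ≡ (A · x m) zero + 1ℚ
    ratio m = trans (sym (apply-x m zero))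
      (trans (apply-A (x m) zero) (cong ((A · x m) zero +_) (x₀≡1 m)))

    A-x : ∀ m i → (A · x m) i + x m i ≡ x (suc m) i * ((A · x m) zero + 1ℚ)
    A-x m i = begin
      (A · x m) i + x m i                         ≡⟨ apply-A (x m) i ⟨
      apply (x m) i                               ≡⟨ apply-x m i ⟩
      v (suc m) i * scale m                       ≡⟨ cong (_* scale m) (x-scale (suc m) i) ⟩
      x (suc m) i * v (suc m) zero * scale m      ≡⟨ *-assoc (x (suc m) i) (v (suc m) zero) (scale m) ⟩
      x (suc m) i * (v (suc m) zero * scale m)    ≡⟨ cong (x (suc m) i *_) (ratio m) ⟩
      x (suc m) i * ((A · x m) zero + 1ℚ)         ∎
      where open ≡-Reasoning

    vector : Vector ℝ (suc n)
    vector i = mkℝ (λ m → x m i) (x-cauchy i)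

    -- The eigenvector has base coordinate 1, so its eigenvalue is the base coordinate of its image.
    -- Being a finite sum of reals, it needs no convergence proof of its own.
    ρ : ℝ
    ρ = ∑ (λ j → real A zero j Defs.* vector j)

    seq-ρ : ∀ m → seq ρ m ≡ (A · x m) zero
    seq-ρ = seq-∑ (λ j → real A zero j Defs.* vector j)

    -- With `y` and `z` consecutive iterates at one coordinate, the eigenvalue defect is `p + 1`
    -- times their difference. It tends to zero because the iterates are Cauchy and `ρ` is bounded.
    residual : ∀ a p y z → a + y ≡ z * (p + 1ℚ) → a - p * y ≡ (p + 1ℚ) * (z - y)
    residual a p y z eq = begin
      a - p * y              ≡⟨ solve 3 (λ a p y → a :- p :* y := a :+ y :- y :* (p :+ con 1ℚ)) refl a p y ⟩
      a + y - y * (p + 1ℚ)   ≡⟨ cong (_- y * (p + 1ℚ)) eq ⟩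
      z * (p + 1ℚ) - y * (p + 1ℚ)
                             ≡⟨ solve 3 (λ p y z → z :* p :- y :* p := p :* (z :- y)) refl (p + 1ℚ) y z ⟩
      (p + 1ℚ) * (z - y)     ∎
      where open ≡-Reasoning

    vector-eigen : ∀ i → ∑ (λ j → real A i j Defs.* vector j) ≃ ρ Defs.* vector i
    vector-eigen i ε 0<ε =
      let b , b>0 , N , hN = bounded (cauchy ρ)
          b+1>0 = positive (+-mono-< (positive⁻¹ b {{b>0}}) 0<1)
          d , 0<d , eq = quotient (b + 1ℚ) ε b+1>0 0<ε
          N′ , hN′ = x-cauchy i d 0<d
      in N ℕ.⊔ N′ , λ m p →
        subst₂ (λ z e → ∣ z ∣ < e)
          (sym (trans (cong₂ (λ a b → a - b * x m i) (seq-∑ (λ j → real A i j Defs.* vector j) m) (seq-ρ m))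
                 (residual ((A · x m) i) ((A · x m) zero) (x m i) (x (suc m) i) (A-x m i))))
          eq
          (product-< ((A · x m) zero + 1ℚ) (x (suc m) i - x m i) b+1>0
            (≤-trans (∣p+q∣≤∣p∣+∣q∣ ((A · x m) zero) 1ℚ)
              (+-monoˡ-≤ 1ℚ (subst (λ z → ∣ z ∣ ≤ b) (seq-ρ m) (hN m (ℕ.m⊔n≤o⇒m≤o N N′ p)))))
            (hN′ (suc m) m (ℕ.m≤n⇒m≤1+n (ℕ.m⊔n≤o⇒n≤o N N′ p)) (ℕ.m⊔n≤o⇒n≤o N N′ p)))

    vector-nonzero : ¬ (∀ i → vector i ≃ Defs.0ℝ)
    vector-nonzero h =
      let N , hN = h zero 1ℚ 0<1
      in <-irrefl refl (subst (λ z → ∣ z - 0ℚ ∣ < 1ℚ) (x₀≡1 N) (hN N ℕ.≤-refl))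

    ρ-eigenvalue : IsEigenvalue (real A) ρ
    ρ-eigenvalue = vector , vector-nonzero , vector-eigen

    -- The iteration starts at `w` itself, and a positive matrix preserves
    -- `(q + 1) * v m ≤ v (suc m)`. So the bound holds at every approximation of `ρ`, without loss
    -- in the limit.
    ≤ρ : ∀ q → (∀ i → q * w i ≤ (A · w) i) → ∀ m → q ≤ seq ρ m
    ≤ρ q h m = subst (q ≤_) (sym (seq-ρ m))
      (subst₂ _≤_ (cancel q) (cancel ((A · x m) zero)) (+-monoˡ-≤ (- 1ℚ) scaled))
      where
      open ≤-Reasoning
      cancel : ∀ a → a + 1ℚ + (- 1ℚ) ≡ a
      cancel = solve 1 (λ a → a :+ con 1ℚ :+ con (- 1ℚ) := a) refl
      grow : ∀ m i → (q + 1ℚ) * v m i ≤ v (suc m) i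
      grow zero i = begin
        (q + 1ℚ) * w i       ≡⟨ solve 2 (λ q w → (q :+ con 1ℚ) :* w := q :* w :+ w) refl q (w i) ⟩
        q * w i + w i        ≤⟨ +-monoˡ-≤ (w i) (h i) ⟩
        (A · w) i + w i      ≡⟨ apply-A w i ⟨
        apply w i            ∎
      grow (suc m) i = begin
        (q + 1ℚ) * apply (v m) i               ≡⟨ apply-scale (q + 1ℚ) (v m) i ⟨
        apply (λ j → (q + 1ℚ) * v m j) i       ≤⟨ apply-mono (grow m) i ⟩
        apply (v (suc m)) i                    ∎
      scaled : q + 1ℚ ≤ (A · x m) zero + 1ℚ
      scaled = begin
        q + 1ℚ                              ≡⟨ *-identityʳ (q + 1ℚ) ⟨
        (q + 1ℚ) * 1ℚ                       ≡⟨ cong ((q + 1ℚ) *_) (scale-inv m) ⟨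
        (q + 1ℚ) * (v m zero * scale m)     ≡⟨ *-assoc (q + 1ℚ) (v m zero) (scale m) ⟨
        (q + 1ℚ) * v m zero * scale m       ≤⟨ *-monoʳ (<⇒≤ (scale>0 m)) (grow m zero) ⟩
        v (suc m) zero * scale m            ≡⟨ ratio m ⟩
        (A · x m) zero + 1ℚ                 ∎

  -- Collatz-Wielandt bounds and separation of largest eigenvalues.

  weighted-bound : ∀ {n} (C : Fin (suc n) → Fin (suc n) → ℚ) → (∀ i j → 0ℚ ≤ C i j) →
    ∀ (w : Vector ℚ (suc n)) → (∀ i → 0ℚ < w i) → ∀ q → (∀ i → (C · w) i ≤ q * w i) →
    ∀ b d ε (X : Vector ℚ (suc n)) → 0ℚ < d → q + d ≤ b → (∀ i → ∣ (C · X) i - b * X i ∣ ≤ ε) →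
    ∃ λ i → ∀ j → ∣ X j ∣ * (w i * d) ≤ w j * ε
  weighted-bound C C≥0 w w>0 q Cw≤qw b d ε X 0<d q+d≤b residual = i , bound
    where
    open ≤-Reasoning
    r : Vector ℚ _
    r j = proj₁ (recip (w>0 j))
    -- At the coordinate with the largest `∣ X j ∣ / w j`, the triangle inequality gives
    -- `b * ∣ X i ∣ ≤ q * ∣ X i ∣ + ε`, hence `∣ X i ∣ * d ≤ ε`. Maximality carries this to all
    -- coordinates.
    best = maximiser (λ j → ∣ X j ∣ * r j)
    i = proj₁ best
    wr : ∀ j → w j * r j ≡ 1ℚ
    wr j = proj₂ (proj₂ (recip (w>0 j)))
    best-ratio : ∀ j → ∣ X j ∣ * w i ≤ w j * ∣ X i ∣
    best-ratio j = begin
      ∣ X j ∣ * w i                    ≡⟨ trans (cong (_* (∣ X j ∣ * w i)) (wr j)) (*-identityˡ (∣ X j ∣ * w i)) ⟨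
      w j * r j * (∣ X j ∣ * w i)      ≡⟨ solve 4 (λ a r x b → a :* r :* (x :* b) := a :* b :* (x :* r)) refl (w j) (r j) ∣ X j ∣ (w i) ⟩
      w j * w i * (∣ X j ∣ * r j)      ≤⟨ *-monoˡ (<⇒≤ (*-pos (w>0 j) (w>0 i))) (proj₂ best j) ⟩
      w j * w i * (∣ X i ∣ * r i)      ≡⟨ solve 4 (λ a b x r → a :* b :* (x :* r) := a :* x :* (b :* r)) refl (w j) (w i) ∣ X i ∣ (r i) ⟩
      w j * ∣ X i ∣ * (w i * r i)      ≡⟨ trans (cong (w j * ∣ X i ∣ *_) (wr i)) (*-identityʳ (w j * ∣ X i ∣)) ⟩
      w j * ∣ X i ∣                    ∎
    b∣X∣≤ : b * ∣ X i ∣ ≤ sum (λ j → C i j * ∣ X j ∣) + ε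
    b∣X∣≤ = begin
      b * ∣ X i ∣                      ≤⟨ *-monoʳ (0≤∣p∣ (X i)) (≤∣∣ b) ⟩
      ∣ b ∣ * ∣ X i ∣                  ≡⟨ ∣p*q∣≡∣p∣*∣q∣ b (X i) ⟨
      ∣ b * X i ∣                      ≡⟨ cong ∣_∣ (solve 2 (λ y s → y := s :- (s :- y)) refl (b * X i) ((C · X) i)) ⟩
      ∣ (C · X) i - ((C · X) i - b * X i) ∣
                                       ≤⟨ ∣p-q∣≤∣p∣+∣q∣ ((C · X) i) ((C · X) i - b * X i) ⟩
      ∣ (C · X) i ∣ + ∣ (C · X) i - b * X i ∣
                                       ≤⟨ +-mono-≤ (∣sum∣≤ (λ j → C i j * X j)) (residual i) ⟩
      sum (λ j → ∣ C i j * X j ∣) + ε  ≡⟨ cong (_+ ε) (sum-cong-≗ (λ j → trans (∣p*q∣≡∣p∣*∣q∣ (C i j) (X j)) (cong (_* ∣ X j ∣) (0≤p⇒∣p∣≡p (C≥0 i j))))) ⟩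
      sum (λ j → C i j * ∣ X j ∣) + ε  ∎
    sum≤ : sum (λ j → C i j * ∣ X j ∣) * w i ≤ q * ∣ X i ∣ * w i
    sum≤ = begin
      sum (λ j → C i j * ∣ X j ∣) * w i    ≡⟨ *-distribʳ-sum (w i) (λ j → C i j * ∣ X j ∣) ⟩
      sum (λ j → C i j * ∣ X j ∣ * w i)    ≤⟨ sum-mono-≤ (λ j → subst₂ _≤_ (sym (*-assoc (C i j) ∣ X j ∣ (w i))) (sym (*-assoc (C i j) (w j) ∣ X i ∣)) (*-monoˡ (C≥0 i j) (best-ratio j))) ⟩
      sum (λ j → C i j * w j * ∣ X i ∣)    ≡⟨ *-distribʳ-sum ∣ X i ∣ (λ j → C i j * w j) ⟨
      (C · w) i * ∣ X i ∣                  ≤⟨ *-monoʳ (0≤∣p∣ (X i)) (Cw≤qw i) ⟩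
      q * w i * ∣ X i ∣                    ≡⟨ solve 3 (λ q w x → q :* w :* x := q :* x :* w) refl q (w i) ∣ X i ∣ ⟩
      q * ∣ X i ∣ * w i                    ∎
    C∣X∣≤ : sum (λ j → C i j * ∣ X j ∣) ≤ q * ∣ X i ∣
    C∣X∣≤ = *-cancelʳ (w>0 i) sum≤
    Xᵢ-small : ∣ X i ∣ * d ≤ ε
    Xᵢ-small = begin
      ∣ X i ∣ * d                          ≡⟨ solve 3 (λ x d q → x :* d := (q :+ d) :* x :- q :* x) refl ∣ X i ∣ d q ⟩
      (q + d) * ∣ X i ∣ - q * ∣ X i ∣      ≤⟨ +-monoˡ-≤ (- (q * ∣ X i ∣)) (≤-trans (*-monoʳ (0≤∣p∣ (X i)) q+d≤b)
                                                (≤-trans b∣X∣≤ (+-monoˡ-≤ ε C∣X∣≤))) ⟩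
      q * ∣ X i ∣ + ε - q * ∣ X i ∣        ≡⟨ solve 2 (λ a e → a :+ e :- a := e) refl (q * ∣ X i ∣) ε ⟩
      ε                                    ∎
    bound : ∀ j → ∣ X j ∣ * (w i * d) ≤ w j * ε
    bound j = begin
      ∣ X j ∣ * (w i * d)    ≡⟨ *-assoc ∣ X j ∣ (w i) d ⟨
      ∣ X j ∣ * w i * d      ≤⟨ *-monoʳ (<⇒≤ 0<d) (best-ratio j) ⟩
      w j * ∣ X i ∣ * d      ≡⟨ *-assoc (w j) ∣ X i ∣ d ⟩
      w j * (∣ X i ∣ * d)    ≤⟨ *-monoˡ (<⇒≤ (w>0 j)) Xᵢ-small ⟩
      w j * ε                ∎

  -- Every coordinate of the eigenvector would be forced to zero. The maximising coordinate of
  -- `weighted-bound` may change with the stage of approximation, so its weight is replaced by a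
  -- common lower bound `c`.
  no-larger-eigenvalue : ∀ {n} (C : Fin (suc n) → Fin (suc n) → ℚ) → (∀ i j → 0ℚ ≤ C i j) →
    ∀ (w : Vector ℚ (suc n)) → (∀ i → 0ℚ < w i) → ∀ q → (∀ i → (C · w) i ≤ q * w i) →
    ∀ β → IsEigenvalue (real C) β → ∀ d → 0ℚ < d → ¬ (∃ λ N → ∀ m → N ℕ.≤ m → q + d ≤ seq β m)
  no-larger-eigenvalue C C≥0 w w>0 q Cw≤qw β (X , X≄0 , eigen) d 0<d (N₀ , above) = X≄0 small
    where
    open ≤-Reasoning
    low = positive-lower-bound w w>0
    c = proj₁ low
    0<c = proj₁ (proj₂ low)
    W = sum w
    0<W : 0ℚ < W
    0<W = sum-pos w>0
    small : ∀ j → X j ≃ Defs.0ℝ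
    small j η 0<η = N₀ ℕ.⊔ proj₁ close , λ m p → begin-strict
      ∣ seq (X j) m - 0ℚ ∣   ≡⟨ cong ∣_∣ (solve 1 (λ a → a :- con 0ℚ := a) refl (seq (X j) m)) ⟩
      ∣ seq (X j) m ∣        ≤⟨ bound m (ℕ.m⊔n≤o⇒m≤o N₀ (proj₁ close) p) (ℕ.m⊔n≤o⇒n≤o N₀ (proj₁ close) p) ⟩
      h                      <⟨ <-by {h} {(1ℚ + 1ℚ) * h} 0<h (solve 1 (λ h → h :+ h := (con 1ℚ :+ con 1ℚ) :* h) refl h) ⟩
      (1ℚ + 1ℚ) * h          ≡⟨ proj₂ (proj₂ half) ⟩
      η                      ∎
      where
      half = quotient (1ℚ + 1ℚ) η (positive (+-mono-< 0<1 0<1)) 0<η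
      h = proj₁ half
      0<h = proj₁ (proj₂ half)
      tolerance = quotient W (c * d * h) (positive 0<W) (*-pos (*-pos 0<c 0<d) 0<h)
      ε = proj₁ tolerance
      0<ε = proj₁ (proj₂ tolerance)
      close = eventually-all
        {P = λ i m → ∣ seq (∑ (λ j → real C i j Defs.* X j)) m - seq β m * seq (X i) m ∣ < ε}
        (λ i → eigen i ε 0<ε)
      bound : ∀ m → N₀ ℕ.≤ m → proj₁ close ℕ.≤ m → ∣ seq (X j) m ∣ ≤ h
      bound m N₀≤m N≤m =
        let x = ∣ seq (X j) m ∣
            i , weighted = weighted-bound C C≥0 w w>0 q Cw≤qw (seq β m) d ε (λ i → seq (X i) m) 0<d (above m N₀≤m)
              (λ i → subst (λ z → ∣ z - seq β m * seq (X i) m ∣ ≤ ε)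
                       (seq-∑ (λ j → real C i j Defs.* X j) m) (<⇒≤ (proj₂ close m N≤m i)))
        in *-cancelˡ (*-pos 0<c 0<d) (begin
          c * d * x        ≤⟨ *-monoʳ (0≤∣p∣ (seq (X j) m)) (*-monoʳ (<⇒≤ 0<d) (proj₂ (proj₂ low) i)) ⟩
          w i * d * x      ≡⟨ *-comm (w i * d) x ⟩
          x * (w i * d)    ≤⟨ weighted j ⟩
          w j * ε          ≤⟨ *-monoʳ (<⇒≤ 0<ε) (term≤sum (<⇒≤ ∘ w>0) j) ⟩
          W * ε            ≡⟨ proj₂ (proj₂ tolerance) ⟩
          c * d * h        ∎)

  -- `c` is the least relative gap `(f i - q * z i) / z i`. A fixed margin is needed because each
  -- comparison of reals costs a tolerance.
  uniform-gap : ∀ {n} (f z : Vector ℚ (suc n)) q → (∀ i → 0ℚ < z i) → (∀ i → q * z i < f i) →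
                ∃ λ c → 0ℚ < c × (∀ i → (q + c) * z i ≤ f i)
  uniform-gap f z q z>0 h = c , proj₁ (proj₂ low) , bound
    where
    open ≤-Reasoning
    r : ∀ i → ∃ λ b → 0ℚ < b × z i * b ≡ 1ℚ
    r i = recip (z>0 i)
    g : Vector ℚ _
    g i = (f i - q * z i) * proj₁ (r i)
    low = positive-lower-bound g (λ i → *-pos (<⇒0< (h i)) (proj₁ (proj₂ (r i))))
    c = proj₁ low
    bound : ∀ i → (q + c) * z i ≤ f i
    bound i = begin
      (q + c) * z i                                     ≡⟨ *-distribʳ-+ (z i) q c ⟩
      q * z i + c * z i                                 ≤⟨ +-monoʳ-≤ (q * z i) (*-monoʳ (<⇒≤ (z>0 i)) (proj₂ (proj₂ low) i)) ⟩
      q * z i + (f i - q * z i) * proj₁ (r i) * z i     ≡⟨ solve 4 (λ a f r z → a :+ (f :- a) :* r :* z := a :+ (f :- a) :* (z :* r)) refl (q * z i) (f i) (proj₁ (r i)) (z i) ⟩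
      q * z i + (f i - q * z i) * (z i * proj₁ (r i))   ≡⟨ cong (λ e → q * z i + (f i - q * z i) * e) (proj₂ (proj₂ (r i))) ⟩
      q * z i + (f i - q * z i) * 1ℚ                    ≡⟨ solve 2 (λ a f → a :+ (f :- a) :* con 1ℚ := f) refl (q * z i) (f i) ⟩
      f i                                               ∎

  module Separation {n m} (A : Fin (suc n) → Fin (suc n) → ℚ) (K : ℚ)
    (0<K : 0ℚ < K) (0≤A : ∀ i j → 0ℚ ≤ A i j)
    (1≤A : ∀ i j → i ≢ j → 1ℚ ≤ A i j) (A≤K : ∀ i j → A i j ≤ K)
    (C : Fin (suc m) → Fin (suc m) → ℚ) (C≥0 : ∀ i j → 0ℚ ≤ C i j) where

    separated : ∀ (z : Vector ℚ (suc n)) (w : Vector ℚ (suc m)) → (∀ i → 0ℚ < z i) → (∀ i → 0ℚ < w i) →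
      ∀ q → (∀ i → q * z i < (A · z) i) → (∀ i → (C · w) i ≤ q * w i) →
      ∀ α β → IsLargestEigenvalue (real A) α → IsEigenvalue (real C) β → ¬ (α Defs.≤ β)
    separated z w z>0 w>0 q Az>qz Cw≤qw α β (_ , largest) β-eigen α≤β =
      no-larger-eigenvalue C C≥0 w w>0 q Cw≤qw β β-eigen (e + e) (+-mono-< 0<e 0<e)
        (proj₁ ρ≤α ℕ.⊔ proj₁ α≤β′ , λ l p → above l (ℕ.m⊔n≤o⇒m≤o (proj₁ ρ≤α) (proj₁ α≤β′) p) (ℕ.m⊔n≤o⇒n≤o (proj₁ ρ≤α) (proj₁ α≤β′) p))
      where
      open ≤-Reasoning
      open Perron A K (K + 1ℚ) 0<K refl 0≤A 1≤A A≤K z z>0 using (ρ; ≤ρ; ρ-eigenvalue)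
      gap = uniform-gap (A · z) z q z>0 Az>qz
      c = proj₁ gap
      -- With a quarter of the gap, `ρ ≤ α` and `α ≤ β` lose `e` each, and the remaining `e + e` is
      -- the margin that `no-larger-eigenvalue` forbids.
      four = 1ℚ + 1ℚ + (1ℚ + 1ℚ)
      quarter = quotient four c (positive (+-mono-< (+-mono-< 0<1 0<1) (+-mono-< 0<1 0<1))) (proj₁ (proj₂ gap))
      e = proj₁ quarter
      0<e = proj₁ (proj₂ quarter)
      ρ≤α = largest ρ ρ-eigenvalue e 0<e
      α≤β′ = α≤β e 0<e
      above : ∀ l → proj₁ ρ≤α ℕ.≤ l → proj₁ α≤β′ ℕ.≤ l → q + (e + e) ≤ seq β l
      above l p p′ = begin
        q + (e + e)                  ≡⟨ solve 2 (λ q e → q :+ (e :+ e) := q :+ (con 1ℚ :+ con 1ℚ :+ (con 1ℚ :+ con 1ℚ)) :* e :- (e :+ e)) refl q e ⟩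
        q + four * e - (e + e)       ≡⟨ cong (λ z → q + z - (e + e)) (proj₂ (proj₂ quarter)) ⟩
        q + c - (e + e)              ≤⟨ +-monoˡ-≤ (- (e + e)) (≤ρ (q + c) (proj₂ (proj₂ gap)) l) ⟩
        seq ρ l - (e + e)            ≤⟨ +-monoˡ-≤ (- (e + e)) (<⇒≤ (proj₂ ρ≤α l p)) ⟩
        seq α l + e - (e + e)        ≤⟨ +-monoˡ-≤ (- (e + e)) (+-monoˡ-≤ e (<⇒≤ (proj₂ α≤β′ l p′))) ⟩
        seq β l + e + e - (e + e)    ≡⟨ solve 2 (λ b e → b :+ e :+ e :- (e :+ e) := b) refl (seq β l) e ⟩
        seq β l                      ∎

  -- Strict monotonicity under a single excess entry.

  sum-mono-extra : ∀ {n} {f g : Vector ℚ n} {e} b → (∀ j → f j ≤ g j) → f b + e ≤ g b → sum f + e ≤ sum g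
  sum-mono-extra {suc n} {f} {g} {e} zero h hb = begin
    f zero + sum (f ∘ suc) + e    ≡⟨ solve 3 (λ a s e → a :+ s :+ e := a :+ e :+ s) refl (f zero) (sum (f ∘ suc)) e ⟩
    f zero + e + sum (f ∘ suc)    ≤⟨ +-mono-≤ hb (sum-mono-≤ (h ∘ suc)) ⟩
    g zero + sum (g ∘ suc)        ∎
    where open ≤-Reasoning
  sum-mono-extra {suc n} {f} {g} {e} (suc b) h hb = begin
    f zero + sum (f ∘ suc) + e    ≡⟨ +-assoc (f zero) (sum (f ∘ suc)) e ⟩
    f zero + (sum (f ∘ suc) + e)  ≤⟨ +-mono-≤ (h zero) (sum-mono-extra b (h ∘ suc) hb) ⟩
    g zero + sum (g ∘ suc)        ∎
    where open ≤-Reasoning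

  narrow : ∀ l u K c T W → 0ℚ < c → 0ℚ ≤ K → 0ℚ ≤ T → l ≤ u → (u - l) * (K + c) ≤ W → W * T < c →
           (u - l) * T < 1ℚ
  narrow l u K c T W 0<c 0≤K 0≤T l≤u hyp WT<c = *-cancelʳ-<-nonNeg c {{nonNegative (<⇒≤ 0<c)}} (begin-strict
    (u - l) * T * c          ≤⟨ ≤-by {(u - l) * T * c} {(u - l) * (K + c) * T} (*-nonneg (*-nonneg (≤⇒0≤ l≤u) 0≤T) 0≤K)
                                  (solve 4 (λ w t c k → w :* t :* c :+ w :* t :* k := w :* (k :+ c) :* t) refl (u - l) T c K) ⟩
    (u - l) * (K + c) * T    ≤⟨ *-monoʳ 0≤T hyp ⟩
    W * T                    <⟨ WT<c ⟩
    c                        ≡⟨ *-identityˡ c ⟨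
    1ℚ * c                   ∎)
    where open ≤-Reasoning

  module StrictlyDominated {n m} (K : ℚ) (0<K : 0ℚ < K)
    (A : Fin (suc n) → Fin (suc n) → ℚ) (0≤A : ∀ i j → 0ℚ ≤ A i j)
    (1≤A : ∀ i j → i ≢ j → 1ℚ ≤ A i j) (A≤K : ∀ i j → A i j ≤ K)
    (C : Fin (suc m) → Fin (suc m) → ℚ) (0≤C : ∀ i j → 0ℚ ≤ C i j)
    (1≤C : ∀ i j → i ≢ j → 1ℚ ≤ C i j) (C≤K : ∀ i j → C i j ≤ K)
    (π : Permutation (suc n) (suc m))
    (C≤A : ∀ i j → C (π ⟨$⟩ʳ i) (π ⟨$⟩ʳ j) ≤ A i j)
    (a b : Fin (suc n)) (C<A : C (π ⟨$⟩ʳ a) (π ⟨$⟩ʳ b) + 1ℚ ≤ A a b) where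

    private
      M : ℚ
      M = K + 1ℚ

      module H = Perron C K M 0<K refl 0≤C 1≤C C≤K (λ _ → 1ℚ) (λ _ → 0<1)

    S : ℚ
    S = sum {suc n} (λ _ → M)

    S′ : ℚ
    S′ = sum {suc m} (λ _ → M)

    0<M : 0ℚ < M
    0<M = H.0<M

    0<T : 0ℚ < M * S
    0<T = *-pos 0<M (sum-pos {n} (λ _ → 0<M))

    sum-spread : ∀ {k} (v : Vector ℚ k) c → (∀ j → v j ≤ M * c) → sum v ≤ sum {k} (λ _ → M) * c
    sum-spread {k} v c h = ≤-trans (sum-mono-≤ h) (≤-reflexive (sym (*-distribʳ-sum {k} c (λ _ → M))))

    -- The excess entry will add `w b` to every coordinate, while `u - l` is multiplied by
    -- `z i ≤ M * S * w b`; so the width has to fall below 1 / (M * S). It starts at `M * S′ - 0ℚ`,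
    -- written as the difference that `contract-iterate` expects.
    steps : ∃ λ k → K * (M * S′ - 0ℚ) * (M * S) < ι k × 0ℚ < ι k
    steps = let k , h = archimedean (K * (M * S′ - 0ℚ) * (M * S)) in
      suc k , ≤-<-trans h (ι-mono-< {k} (ℕ.n<1+n k)) , ≤-<-trans (ι-nonneg k) (ι-mono-< {k} (ℕ.n<1+n k))

    private
      k = proj₁ steps
      V = H.v (k ℕ.+ 1)

      V-spread : ∀ i j → V i ≤ M * V j
      V-spread = subst (λ z → ∀ i j → H.v z i ≤ M * H.v z j) (sym (ℕ.+-suc k 0)) (H.v-spread (k ℕ.+ 0))

      initial : H.Between 0ℚ (M * S′) (H.v 1) (H.v 2)
      initial = H.between
        (λ i → ≤-trans (≤-reflexive (*-zeroˡ (H.v 1 i))) (<⇒≤ (H.v>0 2 i)))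
        (λ i → ≤-trans (H.apply≤sum {H.v 1} (<⇒≤ ∘ H.v>0 1) i)
          (≤-trans (*-monoˡ (<⇒≤ 0<M) (sum-spread (H.v 1) (H.v 1 i) (λ j → H.v-spread 0 j i)))
            (≤-reflexive (sym (*-assoc M S′ (H.v 1 i))))))

      bracket : ∃₂ λ l u → H.Between l u V (H.apply V) × l ≤ u × (u - l) * (M * S) < 1ℚ
      bracket =
        let l , u , _ , b , w = H.contract-iterate k (H.v>0 1) initial
            b′ = subst₂ (H.Between l u) (sym (H.iterate-+ k 1 (λ _ → 1ℚ)))
                   (trans (sym (H.iterate-+ k 2 (λ _ → 1ℚ))) (cong H.v (ℕ.+-suc k 1))) b
            l≤u = H.between-≤ (H.v>0 (k ℕ.+ 1)) b′
        in l , u , b′ , l≤u ,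
           narrow l u K (ι k) (M * S) (K * (M * S′ - 0ℚ)) (proj₂ (proj₂ steps)) (<⇒≤ 0<K) (<⇒≤ 0<T) l≤u w (proj₁ (proj₂ steps))

      l = proj₁ bracket
      u = proj₁ (proj₂ bracket)
      V-between = proj₁ (proj₂ (proj₂ bracket))
      l≤u = proj₁ (proj₂ (proj₂ (proj₂ bracket)))
      l≈u = proj₂ (proj₂ (proj₂ (proj₂ bracket)))

      w : Vector ℚ (suc n)
      w i = V (π ⟨$⟩ʳ i)

      w>0 : ∀ i → 0ℚ < w i
      w>0 i = H.v>0 (k ℕ.+ 1) (π ⟨$⟩ʳ i)

      module G = Perron A K M 0<K refl 0≤A 1≤A A≤K w w>0

      z : Vector ℚ (suc n)
      z = G.apply w

      C·V : ∀ i → (C · V) (π ⟨$⟩ʳ i) ≡ sum (λ j → C (π ⟨$⟩ʳ i) (π ⟨$⟩ʳ j) * w j)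
      C·V i = sum-permute (λ j → C (π ⟨$⟩ʳ i) j * V j) π

      entry : ∀ i j → C (π ⟨$⟩ʳ i) (π ⟨$⟩ʳ j) * w j ≤ A i j * w j
      entry i j = *-monoʳ (<⇒≤ (w>0 j)) (C≤A i j)

      entry-ab : C (π ⟨$⟩ʳ a) (π ⟨$⟩ʳ b) * w b + w b ≤ A a b * w b
      entry-ab = ≤-trans
        (≤-reflexive (solve 2 (λ c w → c :* w :+ w := (c :+ con 1ℚ) :* w) refl (C (π ⟨$⟩ʳ a) (π ⟨$⟩ʳ b)) (w b)))
        (*-monoʳ (<⇒≤ (w>0 b)) C<A)

      open ≤-Reasoning

      lw≤z : ∀ i → l * w i ≤ z i
      lw≤z i = begin
        l * w i                                                  ≤⟨ H.Between.lower V-between (π ⟨$⟩ʳ i) ⟩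
        H.apply V (π ⟨$⟩ʳ i)                                     ≡⟨ H.apply-A V (π ⟨$⟩ʳ i) ⟩
        (C · V) (π ⟨$⟩ʳ i) + w i                                 ≡⟨ cong (_+ w i) (C·V i) ⟩
        sum (λ j → C (π ⟨$⟩ʳ i) (π ⟨$⟩ʳ j) * w j) + w i          ≤⟨ +-monoˡ-≤ (w i) (sum-mono-≤ (entry i)) ⟩
        (A · w) i + w i                                          ≡⟨ G.apply-A w i ⟨
        z i                                                      ∎

      lw≤z-a : l * w a + w b ≤ z a
      lw≤z-a = begin
        l * w a + w b                                            ≤⟨ +-monoˡ-≤ (w b) (H.Between.lower V-between (π ⟨$⟩ʳ a)) ⟩
        H.apply V (π ⟨$⟩ʳ a) + w b                               ≡⟨ cong (_+ w b) (trans (H.apply-A V (π ⟨$⟩ʳ a)) (cong (_+ w a) (C·V a))) ⟩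
        sum (λ j → C (π ⟨$⟩ʳ a) (π ⟨$⟩ʳ j) * w j) + w a + w b    ≡⟨ solve 3 (λ s p q → s :+ p :+ q := s :+ q :+ p) refl
                                                                      (sum (λ j → C (π ⟨$⟩ʳ a) (π ⟨$⟩ʳ j) * w j)) (w a) (w b) ⟩
        sum (λ j → C (π ⟨$⟩ʳ a) (π ⟨$⟩ʳ j) * w j) + w b + w a    ≤⟨ +-monoˡ-≤ (w a) (sum-mono-extra b (entry a) entry-ab) ⟩
        (A · w) a + w a                                          ≡⟨ G.apply-A w a ⟨
        z a                                                      ∎

      -- One more application of the positive matrix spreads the excess at a over
      -- all coordinates.
      lz+wb≤Bz : ∀ i → l * z i + w b ≤ G.apply z i
      lz+wb≤Bz i = begin
        l * z i + w b                            ≡⟨ cong (_+ w b) (G.apply-scale l w i) ⟨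
        G.apply (λ j → l * w j) i + w b          ≤⟨ sum-mono-extra a (λ j → *-monoˡ (G.0≤B i j) (lw≤z j)) at-a ⟩
        G.apply z i                              ∎
        where
        at-a : G.B i a * (l * w a) + w b ≤ G.B i a * z a
        at-a = begin
          G.B i a * (l * w a) + w b              ≡⟨ cong (G.B i a * (l * w a) +_) (*-identityˡ (w b)) ⟨
          G.B i a * (l * w a) + 1ℚ * w b         ≤⟨ +-monoʳ-≤ (G.B i a * (l * w a)) (*-monoʳ (<⇒≤ (w>0 b)) (G.1≤B i a)) ⟩
          G.B i a * (l * w a) + G.B i a * w b    ≡⟨ *-distribˡ-+ (G.B i a) (l * w a) (w b) ⟨
          G.B i a * (l * w a + w b)              ≤⟨ *-monoˡ (G.0≤B i a) lw≤z-a ⟩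
          G.B i a * z a                          ∎

      z≤ : ∀ i → z i ≤ M * S * w b
      z≤ i = begin
        z i              ≤⟨ G.apply≤sum {w} (<⇒≤ ∘ w>0) i ⟩
        M * sum w        ≤⟨ *-monoˡ (<⇒≤ 0<M) (sum-spread w (w b) (λ j → V-spread (π ⟨$⟩ʳ j) (π ⟨$⟩ʳ b))) ⟩
        M * (S * w b)    ≡⟨ *-assoc M S (w b) ⟨
        M * S * w b      ∎

      uz<Bz : ∀ i → u * z i < G.apply z i
      uz<Bz i = begin-strict
        u * z i                                ≡⟨ solve 3 (λ u l z → u :* z := l :* z :+ (u :- l) :* z) refl u l (z i) ⟩
        l * z i + (u - l) * z i                ≤⟨ +-monoʳ-≤ (l * z i) (*-monoˡ (≤⇒0≤ l≤u) (z≤ i)) ⟩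
        l * z i + (u - l) * (M * S * w b)      ≡⟨ cong (l * z i +_) (*-assoc (u - l) (M * S) (w b)) ⟨
        l * z i + (u - l) * (M * S) * w b      <⟨ +-monoʳ-< (l * z i) (*-monoˡ-<-pos (w b) {{positive (w>0 b)}} l≈u) ⟩
        l * z i + 1ℚ * w b                     ≡⟨ cong (l * z i +_) (*-identityˡ (w b)) ⟩
        l * z i + w b                          ≤⟨ lz+wb≤Bz i ⟩
        G.apply z i                            ∎

      shift : ∀ q y → (q - 1ℚ) * y ≡ q * y - y
      shift = solve 2 (λ q y → (q :- con 1ℚ) :* y := q :* y :- y) refl

      cancel : ∀ s y → s + y - y ≡ s
      cancel = solve 2 (λ s y → s :+ y :- y := s) refl

      Az> : ∀ i → (u - 1ℚ) * z i < (A · z) i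
      Az> i = subst₂ _<_ (sym (shift u (z i)))
        (trans (cong (_- z i) (G.apply-A z i)) (cancel ((A · z) i) (z i)))
        (+-monoˡ-< (- z i) (uz<Bz i))

      CV≤ : ∀ i → (C · V) i ≤ (u - 1ℚ) * V i
      CV≤ i = subst₂ _≤_ (trans (cong (_- V i) (H.apply-A V i)) (cancel ((C · V) i) (V i)))
        (sym (shift u (V i))) (+-monoˡ-≤ (- V i) (H.Between.upper V-between i))

    -- The threshold is `u - 1ℚ`, the shift undoing the identity summand. From `w` to `z` the gain
    -- of `A` is recorded only at `a`; from `z` to its image it is present everywhere, which is why
    -- `z` is the test vector for `A`.
    strictly-larger : ∀ α β → IsLargestEigenvalue (real A) α → IsEigenvalue (real C) β → ¬ (α Defs.≤ β)
    strictly-larger = Separation.separated A K 0<K 0≤A 1≤A A≤K C 0≤C z V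
      (G.v>0 1) (H.v>0 (k ℕ.+ 1)) (u - 1ℚ) Az> CV≤

module Layerings where
  import Algebra.Properties.Semiring.Sum as SemiringSum
  open import Data.Bool.Base using (Bool; true; false; T; not; if_then_else_; _∧_)
  open import Data.Bool.Properties using (T?)
  open import Data.Empty using (⊥-elim)
  open import Data.Fin.Base using (Fin; zero; suc; splitAt; join; punchIn)
  open import Data.Fin.Permutation as Perm using (Permutation; _⟨$⟩ʳ_; _⟨$⟩ˡ_)
  import Data.Fin.Properties as Fin
  open import Data.Fin.Subset as Subset using (Subset; inside; outside; ∁; ∣_∣; Nonempty)
  open import Data.Fin.Subset.Properties using (∣⊥∣≡0)
  open import Data.Integer.Base as ℤ using (ℤ)
  import Data.Integer.Properties as ℤ
  open import Data.List.Base using (length; filter; tabulate)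
  open import Data.Nat.Base
  open import Data.Nat.Divisibility using (_∣_; _∣?_)
  open import Data.Nat.DivMod using (m*n/n≡m; m≥n⇒m/n>0)
  open import Data.Nat.Properties
  open import Data.Nat.Solver using (module +-*-Solver)
  open import Data.Product.Base using (∃; ∃₂; _×_; _,_; proj₁; proj₂)
  import Data.Rational.Base as ℚ
  import Data.Rational.Properties as ℚ
  open import Data.Sum.Base as Sum using (_⊎_; inj₁; inj₂; [_,_]′)
  open import Data.Unit.Base using (tt)
  open import Data.Vec.Base using ([]; _∷_; lookup)
  open import Data.Vec.Functional using (Vector; removeAt)
  open import Data.Vec.Properties using (lookup-map; []=⇒lookup)
  open import Function.Base using (_∘_; id)
  open import Function.Bundles using (mk⇔)
  open import Relation.Binary.PropositionalEquality
  open import Relation.Nullary using (¬_; Dec; yes; no; does; contradiction)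
  open import Relation.Nullary.Decidable
    using (True; toWitness; from-yes; map′; dec-true; does-⇔; ¬?; _×-dec_; _→-dec_)
  open import Defs hiding (_≤_; _+_; _*_)
  open import Defs using () renaming (_≤_ to _≤ℝ_)

  open SemiringSum +-*-semiring using (sum; sum-cong-≗; sum-remove)
  open +-*-Solver
  open SpectralComparison using (ι; ι-+; ι-*; ι-mono-≤; ι-mono-<; ι-nonneg; recip; ratio-<; ratio-≤;
                                 _·_; real; module Separation; module StrictlyDominated)

  -- Distances and the comparison of distance spectral radii.

  least-bounded : {P : ℕ → Set} (P? : ∀ d → Dec (P d)) (b : ℕ) → least P? b ≤ b
  least-bounded P? zero    = z≤n
  least-bounded P? (suc b) with P? 0
  ... | yes _ = z≤n
  ... | no _  = s≤s (least-bounded (P? ∘ suc) b)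

  least-pos : {P : ℕ → Set} (P? : ∀ d → Dec (P d)) (b : ℕ) → ¬ P 0 → 1 ≤ least P? (suc b)
  least-pos P? b ¬p with P? 0
  ... | yes p = contradiction p ¬p
  ... | no _  = s≤s z≤n

  -- `least` falls back on its bound when it finds no walk, so this covers unreachable pairs too. It
  -- supplies the entry bound of the matrix lemmas.
  dist-bounded : ∀ {n} (G : Graph n) u v → dist G u v ≤ n
  dist-bounded {n} G u v = least-bounded (λ d → walk? G d u v) n

  dist-pos : ∀ {n} (G : Graph n) u v → u ≢ v → 1 ≤ dist G u v
  dist-pos {suc n} G u v u≢v = least-pos (λ d → walk? G d u v) n λ { [] → u≢v refl }

  dist-nonadjacent : ∀ {n} (G : Graph n) → Connected G → ∀ {u v} → u ≢ v → ¬ Adj G u v → 2 ≤ dist G u v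
  dist-nonadjacent G conn {u} {v} u≢v ¬a = long (dist-walk G (conn u v))
    where
    long : ∀ {d} → Walk G d u v → 2 ≤ d
    long []            = contradiction refl u≢v
    long (a ∷ [])      = contradiction a ¬a
    long (_ ∷ (_ ∷ _)) = s≤s (s≤s z≤n)

  adj-distinct : ∀ {n} (G : Graph n) {u v} → Adj G u v → u ≢ v
  adj-distinct G {u} a refl = subst T (adj-irrefl G u) a

  Dℚ : ∀ {n} → Graph n → Fin n → Fin n → ℚ.ℚ
  Dℚ G i j = ι (dist G i j)

  distances : ∀ {n} → Graph n → Vector ℕ n → Vector ℕ n
  distances G w i = sum (λ j → dist G i j * w j)

  ι-distances : ∀ {n} (G : Graph n) (w : Vector ℕ n) i → ι (distances G w i) ≡ (Dℚ G · (ι ∘ w)) i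
  ι-distances G w i = go (λ j → dist G i j) w
    where
    go : ∀ {k} (f g : Vector ℕ k) → ι (sum (λ j → f j * g j)) ≡ _·_ {1} (λ _ j → ι (f j)) (ι ∘ g) zero
    go {zero}  f g = refl
    go {suc k} f g = trans (ι-+ (f zero * g zero) (sum (λ j → f (suc j) * g (suc j))))
      (cong₂ ℚ._+_ (ι-* (f zero) (g zero)) (go (f ∘ suc) (g ∘ suc)))

  D-real : ∀ {n} (G : Graph n) → D G ≡ real (Dℚ G)
  D-real G = refl

  -- Opaque, so that conversion never unfolds the eigenvalue predicates down to
  -- Cauchy sequences.
  opaque
    Exceeds : ∀ {n m} → Graph n → Graph m → Set
    Exceeds G H = ∀ α β → IsLargestEigenvalue (D G) α → IsEigenvalue (D H) β → ¬ (α ≤ℝ β)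

    exceeds : ∀ {n m} (G : Graph n) (H : Graph m) →
      (∀ α β → IsLargestEigenvalue (real (Dℚ G)) α → IsEigenvalue (real (Dℚ H)) β → ¬ (α ≤ℝ β)) →
      Exceeds G H
    exceeds G H h α β α-largest β-eigen =
      h α β (subst (λ A → IsLargestEigenvalue A α) (D-real G) α-largest)
            (subst (λ A → IsEigenvalue A β) (D-real H) β-eigen)

    refute : ∀ {n m} {G : Graph n} {H : Graph m} → Exceeds G H →
      ∀ α β → IsLargestEigenvalue (D G) α → IsLargestEigenvalue (D H) β → ¬ (α ≤ℝ β)
    refute h α β α-largest β-largest = h α β α-largest (proj₁ β-largest)

  module _ {n m} (G : Graph (suc n)) (H : Graph (suc m)) where

    private
      N = suc n ⊔ suc m

      0<N : ℚ.0ℚ ℚ.< ι N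
      0<N = ι-mono-< {0} {N} (≤-trans (s≤s z≤n) (m≤m⊔n (suc n) (suc m)))

    -- With q = p / r cleared of its denominator and natural weights, both Collatz-Wielandt
    -- hypotheses become inequalities of naturals, to be settled by evaluation or by an explicit
    -- slack.
    ratio-exceeds : ∀ p r → 1 ≤ r → (z : Vector ℕ (suc n)) (w : Vector ℕ (suc m)) →
      (∀ i → 1 ≤ z i) → (∀ i → 1 ≤ w i) →
      (∀ i → p * z i < r * distances G z i) → (∀ i → r * distances H w i ≤ p * w i) →
      Exceeds G H
    ratio-exceeds p r r≥1 z w z≥1 w≥1 lower upper = exceeds G H
      (Separation.separated (Dℚ G) (ι N) 0<N (λ i j → ι-nonneg (dist G i j))
        (λ i j i≢j → ι-mono-≤ {1} {dist G i j} (dist-pos G i j i≢j))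
        (λ i j → ι-mono-≤ {dist G i j} {N} (≤-trans (dist-bounded G i j) (m≤m⊔n (suc n) (suc m))))
        (Dℚ H) (λ i j → ι-nonneg (dist H i j))
        (ι ∘ z) (ι ∘ w) (λ i → ι-mono-< {0} {z i} (z≥1 i)) (λ i → ι-mono-< {0} {w i} (w≥1 i)) q
        lowerℚ upperℚ)
      where
      0<r : ℚ.0ℚ ℚ.< ι r
      0<r = ι-mono-< {0} {r} r≥1
      division : ∃ λ q → q ℚ.* ι r ≡ ι p
      division = ι p ℚ.* proj₁ (recip 0<r) ,
        trans (ℚ.*-assoc (ι p) (proj₁ (recip 0<r)) (ι r))
          (trans (cong (ι p ℚ.*_) (trans (ℚ.*-comm (proj₁ (recip 0<r)) (ι r)) (proj₂ (proj₂ (recip 0<r)))))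
            (ℚ.*-identityʳ (ι p)))
      q = proj₁ division
      lowerℚ : ∀ i → q ℚ.* ι (z i) ℚ.< (Dℚ G · (ι ∘ z)) i
      lowerℚ i = ratio-< (ι p) (ι r) q (ι (z i)) ((Dℚ G · (ι ∘ z)) i) 0<r (proj₂ division)
        (subst₂ ℚ._<_ (ι-* p (z i)) (trans (ι-* r (distances G z i)) (cong (ι r ℚ.*_) (ι-distances G z i)))
          (ι-mono-< {p * z i} {r * distances G z i} (lower i)))
      upperℚ : ∀ i → (Dℚ H · (ι ∘ w)) i ℚ.≤ q ℚ.* ι (w i)
      upperℚ i = ratio-≤ (ι p) (ι r) q (ι (w i)) ((Dℚ H · (ι ∘ w)) i) 0<r (proj₂ division)
        (subst₂ ℚ._≤_ (trans (ι-* r (distances H w i)) (cong (ι r ℚ.*_) (ι-distances H w i))) (ι-* p (w i))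
          (ι-mono-≤ {r * distances H w i} {p * w i} (upper i)))

    domination-exceeds : (π : Permutation (suc n) (suc m)) →
      (∀ i j → dist H (π ⟨$⟩ʳ i) (π ⟨$⟩ʳ j) ≤ dist G i j) →
      ∀ a b → dist H (π ⟨$⟩ʳ a) (π ⟨$⟩ʳ b) < dist G a b →
      Exceeds G H
    domination-exceeds π le a b lt = exceeds G H
      (StrictlyDominated.strictly-larger (ι N) 0<N
        (Dℚ G) (λ i j → ι-nonneg (dist G i j))
        (λ i j i≢j → ι-mono-≤ {1} {dist G i j} (dist-pos G i j i≢j))
        (λ i j → ι-mono-≤ {dist G i j} {N} (≤-trans (dist-bounded G i j) (m≤m⊔n (suc n) (suc m))))
        (Dℚ H) (λ i j → ι-nonneg (dist H i j))
        (λ i j i≢j → ι-mono-≤ {1} {dist H i j} (dist-pos H i j i≢j))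
        (λ i j → ι-mono-≤ {dist H i j} {N} (≤-trans (dist-bounded H i j) (m≤n⊔m (suc n) (suc m))))
        π (λ i j → ι-mono-≤ {dist H (π ⟨$⟩ʳ i) (π ⟨$⟩ʳ j)} {dist G i j} (le i j)) a b
        -- Distances are integers, so a strict excess is at least one.
        (subst (ℚ._≤ ι (dist G a b))
          (trans (ι-+ 1 (dist H (π ⟨$⟩ʳ a) (π ⟨$⟩ʳ b))) (ℚ.+-comm ℚ.1ℚ (ι (dist H (π ⟨$⟩ʳ a) (π ⟨$⟩ʳ b)))))
          (ι-mono-≤ {suc (dist H (π ⟨$⟩ʳ a) (π ⟨$⟩ʳ b))} {dist G a b} lt)))

  walk-image : ∀ {m n} {G : Graph m} {H : Graph n} (f : Fin m → Fin n) →
               (∀ {u v} → Adj G u v → Adj H (f u) (f v)) → ∀ {d u v} → Walk G d u v → Walk H d (f u) (f v)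
  walk-image f h []      = []
  walk-image f h (a ∷ p) = h a ∷ walk-image f h p

  -- A missing edge of H has distance 1 in H but at least 2 in G.
  subgraph-exceeds : ∀ {n m} (G : Graph (suc n)) (H : Graph (suc m)) → Connected G →
    (π : Permutation (suc n) (suc m)) → (∀ {u v} → Adj G u v → Adj H (π ⟨$⟩ʳ u) (π ⟨$⟩ʳ v)) → ¬ G ≅ H →
    Exceeds G H
  subgraph-exceeds G H conn π G⊆H G≇H = decide (Fin.any? λ u → Fin.any? λ v → missing? u v)
    where
    Missing : Fin _ → Fin _ → Set
    Missing u v = Adj H (π ⟨$⟩ʳ u) (π ⟨$⟩ʳ v) × ¬ Adj G u v
    missing? : ∀ u v → Dec (Missing u v)
    missing? u v = adj? H (π ⟨$⟩ʳ u) (π ⟨$⟩ʳ v) ×-dec ¬? (adj? G u v)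
    same : ¬ ∃₂ Missing → ∀ u v → adj G u v ≡ adj H (π ⟨$⟩ʳ u) (π ⟨$⟩ʳ v)
    same none u v with adj G u v in eqG | adj H (π ⟨$⟩ʳ u) (π ⟨$⟩ʳ v) in eqH
    ... | true  | true  = refl
    ... | false | false = refl
    ... | true  | false = ⊥-elim (subst T eqH (G⊆H (subst T (sym eqG) tt)))
    ... | false | true  = contradiction (u , v , subst T (sym eqH) tt , subst T eqG) none
    decide : Dec (∃₂ Missing) → Exceeds G H
    decide (no none) = contradiction (π , same none) G≇H
    decide (yes (u , v , aH , ¬aG)) = domination-exceeds G H π
      (λ i j → dist-minimal H (walk-image (π ⟨$⟩ʳ_) G⊆H (dist-walk G (conn i j)))) u v
      (≤-<-trans (dist-minimal H (aH ∷ []))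
        (dist-nonadjacent G conn (λ u≡v → adj-distinct H aH (cong (π ⟨$⟩ʳ_) u≡v)) ¬aG))

  -- Vertex classes and class-constant weights.

  ℕsum-mono : ∀ {n} {f g : Vector ℕ n} → (∀ i → f i ≤ g i) → sum f ≤ sum g
  ℕsum-mono {zero}  h = z≤n
  ℕsum-mono {suc n} h = +-mono-≤ (h zero) (ℕsum-mono (h ∘ suc))

  -- In use, `i` is the vertex of the row: its distance to itself is 0 while its class distance is 1
  -- or 2, so this term is compared separately, with `e` as the correction.
  sum-exceptˡ : ∀ {n} {f g : Vector ℕ n} {e} i → (∀ j → i ≢ j → f j ≤ g j) → f i + e ≤ g i → sum f + e ≤ sum g
  sum-exceptˡ {suc n} {f} {g} {e} i h hᵢ = begin
    sum f + e                             ≡⟨ cong (_+ e) (sum-remove {i = i} f) ⟩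
    f i + sum (removeAt f i) + e          ≡⟨ solve 3 (λ a s e → a :+ s :+ e := a :+ e :+ s) refl (f i) (sum (removeAt f i)) e ⟩
    f i + e + sum (removeAt f i)          ≤⟨ +-mono-≤ hᵢ (ℕsum-mono λ j → h (punchIn i j) (Fin.punchInᵢ≢i i j ∘ sym)) ⟩
    g i + sum (removeAt g i)              ≡⟨ sum-remove {i = i} g ⟨
    sum g                                 ∎
    where open ≤-Reasoning

  sum-exceptʳ : ∀ {n} {f g : Vector ℕ n} {e} i → (∀ j → i ≢ j → f j ≤ g j) → f i ≤ g i + e → sum f ≤ sum g + e
  sum-exceptʳ {suc n} {f} {g} {e} i h hᵢ = begin
    sum f                                 ≡⟨ sum-remove {i = i} f ⟩
    f i + sum (removeAt f i)              ≤⟨ +-mono-≤ hᵢ (ℕsum-mono λ j → h (punchIn i j) (Fin.punchInᵢ≢i i j ∘ sym)) ⟩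
    g i + e + sum (removeAt g i)          ≡⟨ solve 3 (λ a s e → a :+ e :+ s := a :+ s :+ e) refl (g i) (sum (removeAt g i)) e ⟩
    g i + sum (removeAt g i) + e          ≡⟨ cong (_+ e) (sum-remove {i = i} g) ⟨
    sum g + e                             ∎
    where open ≤-Reasoning

  -- The vertex classes of K_s ∨ (K_t ∪ c K₁): S itself, the rest, and the
  -- vertices isolated by deleting S.
  data Class : Set where
    hub bulk leaf : Class

  joined : Class → Class → Bool
  joined hub  _    = true
  joined bulk leaf = false
  joined bulk _    = true
  joined leaf hub  = true
  joined leaf _    = false

  joined-hub : ∀ x → T (joined x hub)
  joined-hub hub  = tt
  joined-hub bulk = tt
  joined-hub leaf = tt

  distance : Class → Class → ℕ
  distance x y = if joined x y then 1 else 2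

  indicator : Class → Class → ℕ
  indicator hub  hub  = 1
  indicator bulk bulk = 1
  indicator leaf leaf = 1
  indicator _    _    = 0

  count : ∀ {n} → (Fin n → Class) → Class → ℕ
  count cls x = sum (λ j → indicator (cls j) x)

  indicator-refl : ∀ x → indicator x x ≡ 1
  indicator-refl hub  = refl
  indicator-refl bulk = refl
  indicator-refl leaf = refl

  indicator⁻¹ : ∀ x y → 1 ≤ indicator x y → x ≡ y
  indicator⁻¹ hub  hub  _ = refl
  indicator⁻¹ bulk bulk _ = refl
  indicator⁻¹ leaf leaf _ = refl

  total : (Class → ℕ) → (Class → ℕ) → ℕ
  total N g = N hub * g hub + N bulk * g bulk + N leaf * g leaf

  sum-classes : ∀ {n} (cls : Fin n → Class) (g : Class → ℕ) → sum (g ∘ cls) ≡ total (count cls) g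
  sum-classes {zero}  cls g = refl
  sum-classes {suc n} cls g = trans (cong₂ _+_ (pick (cls zero)) (sum-classes (cls ∘ suc) g))
    (solve 9 (λ a b c x y z p q r → a :* p :+ b :* q :+ c :* r :+ (x :* p :+ y :* q :+ z :* r)
       := (a :+ x) :* p :+ (b :+ y) :* q :+ (c :+ z) :* r) refl
       (indicator (cls zero) hub) (indicator (cls zero) bulk) (indicator (cls zero) leaf)
       (count (cls ∘ suc) hub) (count (cls ∘ suc) bulk) (count (cls ∘ suc) leaf) (g hub) (g bulk) (g leaf))
    where
    pick : ∀ x → g x ≡ total (indicator x) g
    pick hub  = solve 1 (λ a → a := a :+ con 0 :+ con 0 :+ con 0) refl (g hub)
    pick bulk = solve 1 (λ a → a := a :+ con 0 :+ con 0) refl (g bulk)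
    pick leaf = solve 1 (λ a → a := a :+ con 0) refl (g leaf)

  count-pos : ∀ {n} (cls : Fin n → Class) j → 1 ≤ count cls (cls j)
  count-pos {suc n} cls j = begin
    1                                                 ≡⟨ indicator-refl (cls j) ⟨
    indicator (cls j) (cls j)                         ≤⟨ m≤m+n _ _ ⟩
    indicator (cls j) (cls j) + sum (removeAt (λ i → indicator (cls i) (cls j)) j)
                                                      ≡⟨ sum-remove {i = j} (λ i → indicator (cls i) (cls j)) ⟨
    count cls (cls j)                                 ∎
    where open ≤-Reasoning

  count-witness : ∀ {n} (cls : Fin n → Class) x → 1 ≤ count cls x → ∃ λ j → cls j ≡ x
  count-witness {suc n} cls x h with indicator (cls zero) x in eq
  ... | suc _ = zero , indicator⁻¹ (cls zero) x (subst (1 ≤_) (sym eq) (s≤s z≤n))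
  ... | zero  with j , p ← count-witness (cls ∘ suc) x h = suc j , p

  -- Equal counts provide a partner in the class of the first vertex, and removing both keeps the
  -- counts equal. The extremal graphs live on types such as `Fin (1 + (m + 1))`, so the
  -- identification with the vertices of `G` has to be built.
  matching : ∀ {n m} (cls : Fin n → Class) (cls′ : Fin m → Class) → (∀ x → count cls x ≡ count cls′ x) →
             ∃ λ (π : Permutation n m) → ∀ i → cls′ (π ⟨$⟩ʳ i) ≡ cls i
  matching {zero}  {zero}  cls cls′ h = Perm.id , λ ()
  matching {zero}  {suc m} cls cls′ h = contradiction (subst (1 ≤_) (sym (h (cls′ zero))) (count-pos cls′ zero)) λ ()
  matching {suc n} {zero}  cls cls′ h = contradiction (subst (1 ≤_) (h (cls zero)) (count-pos cls zero)) λ ()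
  matching {suc n} {suc m} cls cls′ h = Perm.insert zero j (proj₁ rest) , classes
    where
    same = count-witness cls′ (cls zero) (subst (1 ≤_) (h (cls zero)) (count-pos cls zero))
    j = proj₁ same
    rest = matching (cls ∘ suc) (cls′ ∘ punchIn j) λ x → +-cancelˡ-≡ (indicator (cls zero) x) _ _ (begin
      count cls x                                              ≡⟨ h x ⟩
      count cls′ x                                             ≡⟨ sum-remove {i = j} (λ i → indicator (cls′ i) x) ⟩
      indicator (cls′ j) x + count (cls′ ∘ punchIn j) x        ≡⟨ cong (λ y → indicator y x + count (cls′ ∘ punchIn j) x) (proj₂ same) ⟩
      indicator (cls zero) x + count (cls′ ∘ punchIn j) x      ∎)
      where open ≡-Reasoning
    classes : ∀ i → cls′ (Perm.insert zero j (proj₁ rest) ⟨$⟩ʳ i) ≡ cls i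
    classes zero    = proj₂ same
    classes (suc i) = trans (cong cls′ (Perm.insert-punchIn zero j (proj₁ rest) i)) (proj₂ rest i)

  -- Containment in, respectively of, the graph K_s ∨ (K_t ∪ c K₁) described by `cls`. The first
  -- yields lower bounds on distances, for `G`; the second upper bounds, for the extremal graph.
  Sublayered Superlayered : ∀ {n} → Graph n → (Fin n → Class) → Set
  Sublayered   G cls = ∀ {u v} → Adj G u v → T (joined (cls u) (cls v))
  Superlayered G cls = ∀ {u v} → u ≢ v → T (joined (cls u) (cls v)) → Adj G u v

  module _ {n} (G : Graph n) (cls : Fin n → Class) where

    sublayered-dist : Connected G → Sublayered G cls → ∀ {u v} → u ≢ v → distance (cls u) (cls v) ≤ dist G u v
    sublayered-dist conn sub {u} {v} u≢v with joined (cls u) (cls v) in eq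
    ... | true  = dist-pos G u v u≢v
    ... | false = dist-nonadjacent G conn u≢v (λ a → subst T eq (sub a))

    -- Every class is joined to the hub, so vertices of classes that are not joined are linked in
    -- two steps through `h`, which differs from both.
    superlayered-dist : Superlayered G cls → ∀ h → cls h ≡ hub → ∀ {u v} → u ≢ v → dist G u v ≤ distance (cls u) (cls v)
    superlayered-dist sup h h-hub {u} {v} u≢v with joined (cls u) (cls v) in eq
    ... | true  = dist-minimal G (sup u≢v (subst T (sym eq) tt) ∷ [])
    ... | false = dist-minimal G
          (sup u≢h (subst (T ∘ joined (cls u)) (sym h-hub) (joined-hub (cls u)))
          ∷ (sup (v≢h ∘ sym) (subst (λ x → T (joined x (cls v))) (sym h-hub) tt) ∷ []))
      where
      u≢h : u ≢ h
      u≢h refl = subst T (trans (cong (λ x → joined x (cls v)) (sym h-hub)) eq) tt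
      v≢h : v ≢ h
      v≢h refl = subst T (trans (cong (joined (cls u)) (sym h-hub)) eq) (joined-hub (cls u))

    row : (Class → ℕ) → Class → ℕ
    row ω x = total (count cls) (λ y → distance x y * ω y)

    row-sum : ∀ ω x → sum (λ j → distance x (cls j) * ω (cls j)) ≡ row ω x
    row-sum ω x = sum-classes cls (λ y → distance x y * ω y)

    row≤distances : Connected G → Sublayered G cls → ∀ ω i →
      row ω (cls i) ≤ distances G (ω ∘ cls) i + distance (cls i) (cls i) * ω (cls i)
    row≤distances conn sub ω i = subst (_≤ distances G (ω ∘ cls) i + distance (cls i) (cls i) * ω (cls i)) (row-sum ω (cls i))
      (sum-exceptʳ i (λ j i≢j → *-monoˡ-≤ (ω (cls j)) (sublayered-dist conn sub i≢j)) (m≤n+m _ _))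

    distances≤row : Superlayered G cls → ∀ h → cls h ≡ hub → ∀ ω i →
      distances G (ω ∘ cls) i + distance (cls i) (cls i) * ω (cls i) ≤ row ω (cls i)
    distances≤row sup h h-hub ω i = subst (distances G (ω ∘ cls) i + distance (cls i) (cls i) * ω (cls i) ≤_) (row-sum ω (cls i))
      (sum-exceptˡ i (λ j i≢j → *-monoˡ-≤ (ω (cls j)) (superlayered-dist sup h h-hub i≢j))
        (≤-reflexive (cong (λ d → d * ω (cls i) + distance (cls i) (cls i) * ω (cls i)) dist-refl)))
      where
      dist-refl : dist G i i ≡ 0
      dist-refl = n≤0⇒n≡0 (dist-minimal G [])

  -- Both conditions carry the diagonal term distance x x * ω x on both sides, so
  -- that no truncated subtraction is needed for the own class of a vertex.
  RowsAbove RowsBelow : ℕ → ℕ → (Class → ℕ) → (Class → ℕ) → Set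
  RowsAbove p r N ω = ∀ x → (p + r * distance x x) * ω x < r * total N (λ y → distance x y * ω y)
  RowsBelow p r N ω = ∀ x → r * total N (λ y → distance x y * ω y) ≤ (p + r * distance x x) * ω x

  -- For weights constant on classes, the row sums of class distances depend only on the class of
  -- the vertex, so the inequalities of `ratio-exceeds` reduce to three rows for each graph.
  layered-exceeds : ∀ {n m} (G : Graph n) (H : Graph m) (cls : Fin n → Class) (cls′ : Fin m → Class) →
    Connected G → Sublayered G cls → Superlayered H cls′ → 1 ≤ count cls hub → ∀ h → cls′ h ≡ hub →
    ∀ p r → 1 ≤ r → ∀ ω ω′ → (∀ x → 1 ≤ ω x) → (∀ x → 1 ≤ ω′ x) →
    RowsAbove p r (count cls) ω → RowsBelow p r (count cls′) ω′ →
    Exceeds G H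
  layered-exceeds {zero} G H cls cls′ conn sub sup ()
  layered-exceeds {suc n} {suc m} G H cls cls′ conn sub sup _ h h-hub p r r≥1 ω ω′ ω≥1 ω′≥1 above below =
    ratio-exceeds G H p r r≥1 (ω ∘ cls) (ω′ ∘ cls′) (ω≥1 ∘ cls) (ω′≥1 ∘ cls′)
      (λ i → +-cancelʳ-< (r * (distance (cls i) (cls i) * ω (cls i))) _ _ (begin-strict
        p * ω (cls i) + r * (distance (cls i) (cls i) * ω (cls i))     ≡⟨ regroup p r (distance (cls i) (cls i)) (ω (cls i)) ⟩
        (p + r * distance (cls i) (cls i)) * ω (cls i)                 <⟨ above (cls i) ⟩
        r * row G cls ω (cls i)                                        ≤⟨ *-monoʳ-≤ r (row≤distances G cls conn sub ω i) ⟩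
        r * (distances G (ω ∘ cls) i + distance (cls i) (cls i) * ω (cls i))
                                                                       ≡⟨ *-distribˡ-+ r (distances G (ω ∘ cls) i) _ ⟩
        r * distances G (ω ∘ cls) i + r * (distance (cls i) (cls i) * ω (cls i)) ∎))
      (λ i → +-cancelʳ-≤ (r * (distance (cls′ i) (cls′ i) * ω′ (cls′ i))) _ _ (begin
        r * distances H (ω′ ∘ cls′) i + r * (distance (cls′ i) (cls′ i) * ω′ (cls′ i))
                                                                       ≡⟨ *-distribˡ-+ r (distances H (ω′ ∘ cls′) i) _ ⟨
        r * (distances H (ω′ ∘ cls′) i + distance (cls′ i) (cls′ i) * ω′ (cls′ i))
                                                                       ≤⟨ *-monoʳ-≤ r (distances≤row H cls′ sup h h-hub ω′ i) ⟩
        r * row H cls′ ω′ (cls′ i)                                     ≤⟨ below (cls′ i) ⟩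
        (p + r * distance (cls′ i) (cls′ i)) * ω′ (cls′ i)             ≡⟨ regroup p r (distance (cls′ i) (cls′ i)) (ω′ (cls′ i)) ⟨
        p * ω′ (cls′ i) + r * (distance (cls′ i) (cls′ i) * ω′ (cls′ i)) ∎))
    where
    open ≤-Reasoning
    regroup : ∀ p r d w → p * w + r * (d * w) ≡ (p + r * d) * w
    regroup = solve 4 (λ p r d w → p :* w :+ r :* (d :* w) := (p :+ r :* d) :* w) refl

  spanning-exceeds : ∀ {n m} (G : Graph n) (H : Graph m) (cls : Fin n → Class) (cls′ : Fin m → Class) →
    Connected G → Sublayered G cls → Superlayered H cls′ → (∀ x → count cls x ≡ count cls′ x) →
    1 ≤ count cls hub → ¬ G ≅ H →
    Exceeds G H
  spanning-exceeds {suc n} {zero}  G H cls cls′ conn sub sup same h G≇H =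
    contradiction (subst (1 ≤_) (same hub) h) λ ()
  spanning-exceeds {suc n} {suc m} G H cls cls′ conn sub sup same h G≇H =
    subgraph-exceeds G H conn π
      (λ {u} {v} a → sup (λ eq → adj-distinct G a (injective eq))
        (subst₂ (λ x y → T (joined x y)) (sym (π-cls u)) (sym (π-cls v)) (sub a)))
      G≇H
    where
    π = proj₁ (matching cls cls′ same)
    π-cls = proj₂ (matching cls cls′ same)
    injective : ∀ {u v} → π ⟨$⟩ʳ u ≡ π ⟨$⟩ʳ v → u ≡ v
    injective {u} {v} eq = trans (sym (Perm.inverseˡ π)) (trans (cong (π ⟨$⟩ˡ_) eq) (Perm.inverseˡ π))

  -- Layerings of complete, edgeless and glued graphs.

  complete-superlayered : ∀ n (cls : Fin n → Class) → Superlayered (K n) cls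
  complete-superlayered n cls {u} {v} u≢v _ with u Fin.≟ v
  ... | yes u≡v = u≢v u≡v
  ... | no _    = tt

  edgeless-superlayered : ∀ n → Superlayered (edgeless n) (λ _ → leaf)
  edgeless-superlayered n _ ()

  glue-class : ∀ {m n} → (Fin m → Class) → (Fin n → Class) → Fin (m + n) → Class
  glue-class {m} f g u = [ f , g ]′ (splitAt m u)

  splitAt-injective : ∀ m {n} {u v : Fin (m + n)} → splitAt m u ≡ splitAt m v → u ≡ v
  splitAt-injective m {n} {u} {v} eq = trans (sym (Fin.join-splitAt m n u))
    (trans (cong (join m n) eq) (Fin.join-splitAt m n v))

  glue-superlayered : ∀ {m n} b (G : Graph m) (H : Graph n) {f g} → Superlayered G f → Superlayered H g →
    (∀ x y → T (joined (f x) (g y)) → T b) → (∀ x y → T (joined (g x) (f y)) → T b) →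
    Superlayered (glue b G H) (glue-class f g)
  glue-superlayered {m} b G H G-sup H-sup fg gf {u} {v} u≢v j
    with splitAt m u in equ | splitAt m v in eqv
  ... | inj₁ x | inj₁ y = G-sup (λ x≡y → u≢v (splitAt-injective m (trans equ (trans (cong inj₁ x≡y) (sym eqv))))) j
  ... | inj₂ x | inj₂ y = H-sup (λ x≡y → u≢v (splitAt-injective m (trans equ (trans (cong inj₂ x≡y) (sym eqv))))) j
  ... | inj₁ x | inj₂ y = fg x y j
  ... | inj₂ x | inj₁ y = gf x y j

  sum-splitAt : ∀ m {n} (f : Fin m ⊎ Fin n → ℕ) → sum (f ∘ splitAt m) ≡ sum (f ∘ inj₁) + sum (f ∘ inj₂)
  sum-splitAt zero    f = refl
  sum-splitAt (suc m) f = trans (cong (f (inj₁ zero) +_) (sum-splitAt m (f ∘ Sum.map₁ suc)))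
    (sym (+-assoc (f (inj₁ zero)) _ _))

  count-glue : ∀ {m n} (f : Fin m → Class) (g : Fin n → Class) x →
               count (glue-class f g) x ≡ count f x + count g x
  count-glue {m} f g x = trans (sum-cong-≗ (λ u → split (splitAt m u)))
    (sum-splitAt m [ (λ j → indicator (f j) x) , (λ j → indicator (g j) x) ]′)
    where
    split : ∀ s → indicator ([ f , g ]′ s) x ≡ [ (λ j → indicator (f j) x) , (λ j → indicator (g j) x) ]′ s
    split (inj₁ _) = refl
    split (inj₂ _) = refl

  count-const : ∀ n y x → count {n} (λ _ → y) x ≡ n * indicator y x
  count-const zero    y x = refl
  count-const (suc n) y x = cong (indicator y x +_) (count-const n y x)

  -- From barriers to layerings.

  maxOverSubsets-≥ : ∀ {n} (f : Subset n → ℤ) S → f S ℤ.≤ maxOverSubsets f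
  maxOverSubsets-≥ f []            = ℤ.≤-refl
  maxOverSubsets-≥ f (inside ∷ S)  = ℤ.≤-trans (maxOverSubsets-≥ (f ∘ (inside ∷_)) S) (ℤ.i≤i⊔j _ _)
  maxOverSubsets-≥ f (outside ∷ S) = ℤ.≤-trans (maxOverSubsets-≥ (f ∘ (outside ∷_)) S) (ℤ.i≤j⊔i _ _)

  bergeTutte-even : ∀ {n k} → 2 ∣ k → (G : Graph n) (S : Subset n) →
                    bergeTutte k G S ≡ ℤ.+ (k * i[ G ∖ S ]) ℤ.- ℤ.+ (k * ∣ S ∣)
  bergeTutte-even {k = k} 2∣k G S rewrite dec-true (2 ∣? k) 2∣k = refl

  -- The empty set already gives a nonnegative value, so the maximum is nonnegative. For even `k`
  -- the value at `S` is `k` times the difference of the two sides, and `k` cancels.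
  barrier-isolates : ∀ {n k} → 2 ≤ k → 2 ∣ k → (G : Graph n) (S : Subset n) → IsBarrier k G S → ∣ S ∣ ≤ i[ G ∖ S ]
  barrier-isolates {n} {suc k} _ 2∣k G S barrier =
    *-cancelˡ-≤ (suc k) (ℤ.drop‿+≤+ (ℤ.0≤i-j⇒j≤i (begin
      ℤ.+ 0                                                                   ≤⟨ ℤ.+≤+ z≤n ⟩
      ℤ.+ (suc k * i[ G ∖ Subset.⊥ ])                                         ≡⟨ ℤ.+-identityʳ _ ⟨
      ℤ.+ (suc k * i[ G ∖ Subset.⊥ ]) ℤ.- ℤ.+ 0                               ≡⟨ cong (λ z → ℤ.+ (suc k * i[ G ∖ Subset.⊥ ]) ℤ.- ℤ.+ z) (trans (cong (suc k *_) (∣⊥∣≡0 n)) (*-zeroʳ k)) ⟨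
      ℤ.+ (suc k * i[ G ∖ Subset.⊥ ]) ℤ.- ℤ.+ (suc k * ∣ Subset.⊥ {n} ∣)      ≡⟨ bergeTutte-even 2∣k G Subset.⊥ ⟨
      bergeTutte (suc k) G Subset.⊥                                           ≤⟨ maxOverSubsets-≥ (bergeTutte (suc k) G) Subset.⊥ ⟩
      def (suc k) G                                                           ≡⟨ barrier ⟨
      bergeTutte (suc k) G S                                                  ≡⟨ bergeTutte-even 2∣k G S ⟩
      ℤ.+ (suc k * i[ G ∖ S ]) ℤ.- ℤ.+ (suc k * ∣ S ∣)                        ∎)))
    where open ℤ.≤-Reasoning

  bit : Bool → ℕ
  bit b = if b then 1 else 0

  length-filter-tabulate : ∀ {n} {A : Set} {P : A → Set} (P? : ∀ x → Dec (P x)) (f : Fin n → A) →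
                           length (filter P? (tabulate f)) ≡ sum (λ i → bit (does (P? (f i))))
  length-filter-tabulate {zero}  P? f = refl
  length-filter-tabulate {suc n} P? f with does (P? (f zero))
  ... | true  = cong suc (length-filter-tabulate P? (f ∘ suc))
  ... | false = length-filter-tabulate P? (f ∘ suc)

  sum-embed : ∀ {n} (S : Subset n) (g : Fin n → ℕ) →
              sum (λ u → g (embed S u)) ≡ sum (λ v → if lookup S v then g v else 0)
  sum-embed []            g = refl
  sum-embed (inside ∷ S)  g = cong (g zero +_) (sum-embed S (g ∘ suc))
  sum-embed (outside ∷ S) g = sum-embed S (g ∘ suc)

  lookup-embed : ∀ {n} (S : Subset n) u → lookup S (embed S u) ≡ true
  lookup-embed (inside ∷ S)  zero    = refl
  lookup-embed (inside ∷ S)  (suc u) = lookup-embed S u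
  lookup-embed (outside ∷ S) u       = lookup-embed S u

  embed-surjective : ∀ {n} (S : Subset n) v → lookup S v ≡ true → ∃ λ u → embed S u ≡ v
  embed-surjective (inside ∷ S)  zero    _ = zero , refl
  embed-surjective (inside ∷ S)  (suc v) h with u , eq ← embed-surjective S v h = suc u , cong suc eq
  embed-surjective (outside ∷ S) (suc v) h with u , eq ← embed-surjective S v h = u , cong suc eq

  lookup-∁ : ∀ {n} (S : Subset n) v → lookup (∁ S) v ≡ not (lookup S v)
  lookup-∁ S v = lookup-map v not S

  ∣∣-sum : ∀ {n} (S : Subset n) → ∣ S ∣ ≡ sum (bit ∘ lookup S)
  ∣∣-sum []            = refl
  ∣∣-sum (inside ∷ S)  = cong suc (∣∣-sum S)
  ∣∣-sum (outside ∷ S) = ∣∣-sum S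

  term≤ℕsum : ∀ {n} (f : Vector ℕ n) i → f i ≤ sum f
  term≤ℕsum {suc n} f i = subst (f i ≤_) (sym (sum-remove {i = i} f)) (m≤m+n (f i) _)

  nonempty-size : ∀ {n} (S : Subset n) → Nonempty S → 1 ≤ ∣ S ∣
  nonempty-size S (v , v∈S) = subst₂ _≤_ (cong bit ([]=⇒lookup v∈S)) (sym (∣∣-sum S)) (term≤ℕsum (bit ∘ lookup S) v)

  select : ∀ {n} (b : Fin n → Bool) s → s ≤ sum (bit ∘ b) →
           ∃ λ b′ → (∀ v → T (b′ v) → T (b v)) × sum (bit ∘ b′) ≡ s
  select {n} b zero h = (λ _ → false) , (λ _ ()) , empty n
    where
    empty : ∀ n → sum {n} (λ _ → 0) ≡ 0
    empty zero    = refl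
    empty (suc n) = empty n
  select {suc n} b (suc s) h with b zero in eq
  ... | true with b′ , sub , size ← select (b ∘ suc) s (s≤s⁻¹ h) =
    (λ { zero → true ; (suc v) → b′ v }) ,
    (λ { zero _ → subst T (sym eq) tt ; (suc v) → sub v }) , cong suc size
  ... | false with b′ , sub , size ← select (b ∘ suc) (suc s) h =
    (λ { zero → false ; (suc v) → b′ v }) , (λ { zero () ; (suc v) → sub v }) , size

  module _ {n} (G : Graph n) (S : Subset n) where

    -- Isolation in `G ∖ S` phrased on the original vertices: all neighbours lie in `S`. This avoids
    -- the indexing of `G ∖ S` by `Fin ∣ ∁ S ∣`, which does not fit class counts over `Fin n`.
    Attached : Fin n → Set
    Attached v = ∀ u → T (lookup (∁ S) u) → ¬ Adj G v u

    attached? : ∀ v → Dec (Attached v)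
    attached? v = Fin.all? λ u → T? (lookup (∁ S) u) →-dec ¬? (adj? G v u)

    isolated-⇔ : ∀ u → does (isolated? (G ∖ S) u) ≡ does (attached? (embed (∁ S) u))
    isolated-⇔ u = does-⇔ (mk⇔ to from) (isolated? (G ∖ S) u) (attached? (embed (∁ S) u))
      where
      T⇒≡ : ∀ {b} → T b → b ≡ true
      T⇒≡ {true} _ = refl
      to : (∀ v → ¬ Adj (G ∖ S) u v) → Attached (embed (∁ S) u)
      to h v v∉S with w , refl ← embed-surjective (∁ S) v (T⇒≡ v∉S) = h w
      from : Attached (embed (∁ S) u) → ∀ v → ¬ Adj (G ∖ S) u v
      from h v = h (embed (∁ S) v) (subst T (sym (lookup-embed (∁ S) v)) tt)

    detached : Fin n → Bool
    detached v = lookup (∁ S) v ∧ does (attached? v)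

    isolated-count : i[ G ∖ S ] ≡ sum (bit ∘ detached)
    isolated-count = begin
      i[ G ∖ S ]                                                ≡⟨ length-filter-tabulate (isolated? (G ∖ S)) id ⟩
      sum (λ u → bit (does (isolated? (G ∖ S) u)))              ≡⟨ sum-cong-≗ (λ u → cong bit (isolated-⇔ u)) ⟩
      sum (λ u → bit (does (attached? (embed (∁ S) u))))        ≡⟨ sum-embed (∁ S) (λ v → bit (does (attached? v))) ⟩
      sum (λ v → if lookup (∁ S) v then bit (does (attached? v)) else 0)
                                                                ≡⟨ sum-cong-≗ (λ v → merge (lookup (∁ S) v) (does (attached? v))) ⟩
      sum (bit ∘ detached)                                      ∎
      where
      open ≡-Reasoning
      merge : ∀ a b → (if a then bit b else 0) ≡ bit (a ∧ b)
      merge true  _ = refl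
      merge false _ = refl

    -- Exactly |S| of the isolated vertices are made leaves.
    layering : ∣ S ∣ ≤ i[ G ∖ S ] → ∃ λ cls → Sublayered G cls ×
               count cls hub ≡ ∣ S ∣ × count cls leaf ≡ ∣ S ∣
    layering h = cls , sub , trans (sum-cong-≗ hub-bit) (sym (∣∣-sum S)) , trans (sum-cong-≗ leaf-bit) (proj₂ (proj₂ chosen))
      where
      chosen = select detached ∣ S ∣ (subst (∣ S ∣ ≤_) isolated-count h)
      leaves = proj₁ chosen
      classify : Bool → Bool → Class
      classify true  _     = hub
      classify false true  = leaf
      classify false false = bulk
      cls : Fin n → Class
      cls v = classify (lookup S v) (leaves v)
      ∧-T : ∀ {a b} → T (a ∧ b) → T a × T b
      ∧-T {true} {true} _ = tt , tt
      does⇒ : ∀ {P : Set} (P? : Dec P) → T (does P?) → P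
      does⇒ (yes p) _ = p
      leaf-outside : ∀ v → T (leaves v) → T (lookup (∁ S) v)
      leaf-outside v t = proj₁ (∧-T (proj₁ (proj₂ chosen) v t))
      leaf-attached : ∀ v → T (leaves v) → Attached v
      leaf-attached v t = does⇒ (attached? v) (proj₂ (∧-T {lookup (∁ S) v} (proj₁ (proj₂ chosen) v t)))
      hub-bit : ∀ v → indicator (cls v) hub ≡ bit (lookup S v)
      hub-bit v with lookup S v | leaves v
      ... | true  | _     = refl
      ... | false | true  = refl
      ... | false | false = refl
      leaf-bit : ∀ v → indicator (cls v) leaf ≡ bit (leaves v)
      leaf-bit v with lookup S v in eqS | leaves v in eqL
      ... | true  | true  = ⊥-elim (subst T (trans (lookup-∁ S v) (cong not eqS)) (leaf-outside v (subst T (sym eqL) tt)))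
      ... | true  | false = refl
      ... | false | true  = refl
      ... | false | false = refl
      outside-T : ∀ {v} → lookup S v ≡ false → T (lookup (∁ S) v)
      outside-T {v} eq = subst T (sym (trans (lookup-∁ S v) (cong not eq))) tt
      sub : Sublayered G cls
      sub {u} {v} a with lookup S u in eqSu | leaves u in eqLu | lookup S v in eqSv | leaves v in eqLv
      ... | true  | _     | _     | _     = tt
      ... | false | true  | true  | _     = tt
      ... | false | false | true  | _     = tt
      ... | false | false | false | false = tt
      ... | false | true  | false | _     = ⊥-elim (leaf-attached u (subst T (sym eqLu) tt) v (outside-T eqSv) a)
      ... | false | false | false | true  = leaf-attached v (subst T (sym eqLv) tt) u (outside-T eqSu) (subst T (adj-sym G u v) a)

  shape : ℕ → ℕ → ℕ → Class → ℕ
  shape s t c hub  = s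
  shape s t c bulk = t
  shape s t c leaf = c

  barrier-layering : ∀ {n k} → 2 ≤ k → 2 ∣ k → (G : Graph n) → (∃ λ S → Nonempty S × IsBarrier k G S) →
    ∃ λ cls → Sublayered G cls × ∃₂ λ s t → 1 ≤ s × n ≡ s + (t + s) × (∀ x → count cls x ≡ shape s t s x)
  barrier-layering {n} 2≤k 2∣k G (S , S≢∅ , barrier)
    with cls , sub , hubs , leaves ← layering G S (barrier-isolates 2≤k 2∣k G S barrier) =
    cls , sub , ∣ S ∣ , count cls bulk , nonempty-size S S≢∅ , size ,
    λ { hub → hubs ; bulk → refl ; leaf → leaves }
    where
    open ≡-Reasoning
    ones : ∀ n → sum {n} (λ _ → 1) ≡ n
    ones zero    = refl
    ones (suc n) = cong suc (ones n)
    size : n ≡ ∣ S ∣ + (count cls bulk + ∣ S ∣)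
    size = begin
      n                                                              ≡⟨ ones n ⟨
      sum {n} (λ _ → 1)                                              ≡⟨ sum-classes cls (λ _ → 1) ⟩
      count cls hub * 1 + count cls bulk * 1 + count cls leaf * 1    ≡⟨ cong₂ (λ a b → a * 1 + count cls bulk * 1 + b * 1) hubs leaves ⟩
      ∣ S ∣ * 1 + count cls bulk * 1 + ∣ S ∣ * 1                     ≡⟨ cong₂ _+_ (cong₂ _+_ (*-identityʳ (∣ S ∣)) (*-identityʳ (count cls bulk))) (*-identityʳ (∣ S ∣)) ⟩
      ∣ S ∣ + count cls bulk + ∣ S ∣                                 ≡⟨ +-assoc (∣ S ∣) (count cls bulk) (∣ S ∣) ⟩
      ∣ S ∣ + (count cls bulk + ∣ S ∣)                               ∎

  -- Numerical certificates on the three classes.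

  every? : {P : Class → Set} → (∀ x → Dec (P x)) → Dec (∀ x → P x)
  every? P? = map′ (λ { (a , b , c) → λ { hub → a ; bulk → b ; leaf → c } })
                   (λ h → h hub , h bulk , h leaf)
                   (P? hub ×-dec (P? bulk ×-dec P? leaf))

  -- Weights ω, ω′ and a rational q = p / r witnessing that the distance spectral
  -- radius exceeds q for class sizes N, and is at most q for class sizes N′.
  record Certificate (N N′ : Class → ℕ) : Set where
    field
      p r     : ℕ
      r≥1     : 1 ≤ r
      ω ω′    : Class → ℕ
      ω≥1     : ∀ x → 1 ≤ ω x
      ω′≥1    : ∀ x → 1 ≤ ω′ x
      above   : RowsAbove p r N ω
      below   : RowsBelow p r N′ ω′

  valid? : ∀ (N N′ : Class → ℕ) p r (ω ω′ : Class → ℕ) →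
    Dec (1 ≤ r × (∀ x → 1 ≤ ω x) × (∀ x → 1 ≤ ω′ x) × RowsAbove p r N ω × RowsBelow p r N′ ω′)
  valid? N N′ p r ω ω′ = 1 ≤? r ×-dec (every? (λ x → 1 ≤? ω x) ×-dec (every? (λ x → 1 ≤? ω′ x) ×-dec
    (every? (λ x → _ <? _) ×-dec every? (λ x → _ ≤? _))))

  -- The implicit argument is the verdict of `valid?`, evaluated during type checking, so given
  -- numbers are accepted only if all their inequalities compute to true.
  certify : ∀ s t s′ t′ c′ p r a b c a′ b′ d′ →
    {True (valid? (shape s t s) (shape s′ t′ c′) p r (shape a b c) (shape a′ b′ d′))} →
    Certificate (shape s t s) (shape s′ t′ c′)
  certify s t s′ t′ c′ p r a b c a′ b′ d′ {ok} =
    let r≥1 , ω≥1 , ω′≥1 , above , below = toWitness ok in record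
    { p = p ; r = r ; r≥1 = r≥1 ; ω = shape a b c ; ω′ = shape a′ b′ d′
    ; ω≥1 = ω≥1 ; ω′≥1 = ω′≥1 ; above = above ; below = below }

  ≤-slack : ∀ {a b} k → a + k ≡ b → a ≤ b
  ≤-slack {a} k refl = m≤m+n a k

  <-slack : ∀ {a b} k → 1 + a + k ≡ b → a < b
  <-slack = ≤-slack

  -- The vector (1, 1, 2) shows that the distance spectral radius of
  -- K₁ ∨ (K_{n-2} ∪ K₁) is at most n + 2.
  below-complete : ∀ m → RowsBelow (2 + m + 2) 1 (shape 1 m 1) (shape 1 1 2)
  below-complete m hub  = ≤-slack 2 (solve 1 (λ m →
    con 1 :* (con 1 :* (con 1 :* con 1) :+ m :* (con 1 :* con 1) :+ con 1 :* (con 1 :* con 2)) :+ con 2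
    := (con 2 :+ m :+ con 2 :+ con 1 :* con 1) :* con 1) refl m)
  below-complete m bulk = ≤-slack 0 (solve 1 (λ m →
    con 1 :* (con 1 :* (con 1 :* con 1) :+ m :* (con 1 :* con 1) :+ con 1 :* (con 2 :* con 2)) :+ con 0
    := (con 2 :+ m :+ con 2 :+ con 1 :* con 1) :* con 1) refl m)
  below-complete m leaf = ≤-slack 7 (solve 1 (λ m →
    con 1 :* (con 1 :* (con 1 :* con 1) :+ m :* (con 2 :* con 1) :+ con 1 :* (con 2 :* con 2)) :+ con 7
    := (con 2 :+ m :+ con 2 :+ con 1 :* con 2) :* con 2) refl m)

  -- The hypotheses are the rows for q = n + 2, with n = s + (t + s), after each class has its own
  -- contribution subtracted. The bulk condition thereby loses `t`.
  above-order+2 : ∀ s t a b c → (s + t + 3) * a < t * b + s * c → (2 * s + 3) * b < s * a + 2 * (s * c) →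
    (t + 4) * c < s * a + 2 * (t * b) → RowsAbove (s + (t + s) + 2) 1 (shape s t s) (shape a b c)
  above-order+2 s t a b c hubs bulks leaves hub = subst₂ _<_
    (solve 3 (λ s t a → s :* a :+ (s :+ t :+ con 3) :* a
       := (s :+ (t :+ s) :+ con 2 :+ con 1 :* con 1) :* a) refl s t a)
    (solve 5 (λ s t a b c → s :* a :+ (t :* b :+ s :* c)
       := con 1 :* (s :* (con 1 :* a) :+ t :* (con 1 :* b) :+ s :* (con 1 :* c))) refl s t a b c)
    (+-monoʳ-< (s * a) hubs)
  above-order+2 s t a b c hubs bulks leaves bulk = subst₂ _<_
    (solve 3 (λ s t b → t :* b :+ (con 2 :* s :+ con 3) :* b
       := (s :+ (t :+ s) :+ con 2 :+ con 1 :* con 1) :* b) refl s t b)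
    (solve 5 (λ s t a b c → t :* b :+ (s :* a :+ con 2 :* (s :* c))
       := con 1 :* (s :* (con 1 :* a) :+ t :* (con 1 :* b) :+ s :* (con 2 :* c))) refl s t a b c)
    (+-monoʳ-< (t * b) bulks)
  above-order+2 s t a b c hubs bulks leaves leaf = subst₂ _<_
    (solve 3 (λ s t c → con 2 :* (s :* c) :+ (t :+ con 4) :* c
       := (s :+ (t :+ s) :+ con 2 :+ con 1 :* con 2) :* c) refl s t c)
    (solve 5 (λ s t a b c → con 2 :* (s :* c) :+ (s :* a :+ con 2 :* (t :* b))
       := con 1 :* (s :* (con 1 :* a) :+ t :* (con 2 :* b) :+ s :* (con 2 :* c))) refl s t a b c)
    (+-monoʳ-< (2 * (s * c)) leaves)

  certify-order+2 : ∀ s t a b c {m} → (s + t + 3) * a < t * b + s * c → (2 * s + 3) * b < s * a + 2 * (s * c) →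
    (t + 4) * c < s * a + 2 * (t * b) → {True (every? λ x → 1 ≤? shape a b c x)} → 2 + m ≡ s + (t + s) →
    Certificate (shape s t s) (shape 1 m 1)
  certify-order+2 s t a b c {m} hubs bulks leaves {positive} eq = record
    { p = s + (t + s) + 2 ; r = 1 ; r≥1 = ≤-refl ; ω = shape a b c ; ω′ = shape 1 1 2
    ; ω≥1 = toWitness positive
    ; ω′≥1 = λ { hub → ≤-refl ; bulk → ≤-refl ; leaf → s≤s z≤n }
    ; above = above-order+2 s t a b c hubs bulks leaves
    ; below = subst (λ n → RowsBelow (n + 2) 1 (shape 1 m 1) (shape 1 1 2)) eq (below-complete m) }

  -- Closes the pairs (2,0), (2,2), (2,4), (3,0), (3,2) and (4,0), of orders 4, 6 and 8.
  excluded : ∀ {n} {A : Set} → {True (2 ∣? n)} → {True (n <? 10)} → ¬ 2 ∣ n ⊎ 10 ≤ n → A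
  excluded {n} {_} {even}      (inj₁ odd) = contradiction (toWitness even) odd
  excluded {n} {_} {_} {small} (inj₂ big) = contradiction big (<⇒≱ (toWitness small))

  -- The numbers passed to certify are rounded from the Perron data of the quotient
  -- matrices on the three classes.
  certificate : ∀ s t → 2 ≤ s → ¬ 2 ∣ s + (t + s) ⊎ 10 ≤ s + (t + s) →
                Certificate (shape s t s) (shape 1 (s + (t + s) ∸ 2) 1)
  certificate 0 _ ()
  certificate 1 _ (s≤s ())
  certificate 2 0 _ h = excluded h
  -- In this and the other `certify` cases, p / r is below n + 2, and the extremal graph receives
  -- weights sharper than (1, 1, 2).
  certificate 2 1 _ _ = certify 2 1 1 3 1  59 11  13 19 19  9 11 14
  certificate 2 2 _ h = excluded h
  certificate 2 3 _ _ = certify 2 3 1 5 1  8 1  7 10 12  2 2 3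
  certificate 2 4 _ h = excluded h
  certificate 2 5 _ _ = certify 2 5 1 7 1  21 2  5 7 9  2 2 3
  certificate 2 6 _ _ = certify 2 6 1 8 1  23 2  2 3 4  2 2 3
  -- With seven bulk vertices the hub, bulk and leaf rows hold with margin exactly one: 48 < 49, 35
  -- < 36, 77 < 78. Further bulk vertices add slack to the hub and leaf rows and leave the bulk row
  -- unchanged.
  certificate 2 (suc (2+ (2+ (2+ t)))) _ _ = certify-order+2 2 (7 + t) 4 5 7
    (<-slack (1 * t) (solve 1 (λ t →
      con 1 :+ (con 2 :+ (con 7 :+ t) :+ con 3) :* con 4 :+ (con 1 :* t) := (con 7 :+ t) :* con 5 :+ con 2 :* con 7) refl t))
    (<-slack 0 refl)
    (<-slack (3 * t) (solve 1 (λ t →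
      con 1 :+ ((con 7 :+ t) :+ con 4) :* con 7 :+ (con 3 :* t) := con 2 :* con 4 :+ con 2 :* ((con 7 :+ t) :* con 5)) refl t))
    refl
  certificate 3 0 _ h = excluded h
  certificate 3 1 _ _ = certify 3 1 1 5 1  31 4  2 3 3  6 7 10
  certificate 3 2 _ h = excluded h
  certificate 3 3 _ _ = certify 3 3 1 7 1  21 2  3 4 5  2 2 3
  certificate 3 (2+ (2+ t)) _ _ = certify-order+2 3 (4 + t) 3 4 5
    (<-slack (1 * t) (solve 1 (λ t →
      con 1 :+ (con 3 :+ (con 4 :+ t) :+ con 3) :* con 3 :+ (con 1 :* t) := (con 4 :+ t) :* con 4 :+ con 3 :* con 5) refl t))
    (<-slack 2 refl)
    (<-slack (3 * t) (solve 1 (λ t →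
      con 1 :+ ((con 4 :+ t) :+ con 4) :* con 5 :+ (con 3 :* t) := con 3 :* con 3 :+ con 2 :* ((con 4 :+ t) :* con 4)) refl t))
    refl
  certificate 4 0 _ h = excluded h
  certificate 4 1 _ _ = certify 4 1 1 7 1  31 3  2 3 3  2 2 3
  certificate 4 (2+ t) _ _ = certify-order+2 4 (2 + t) 7 10 11
    (<-slack (3 * t) (solve 1 (λ t →
      con 1 :+ (con 4 :+ (con 2 :+ t) :+ con 3) :* con 7 :+ (con 3 :* t) := (con 2 :+ t) :* con 10 :+ con 4 :* con 11) refl t))
    (<-slack 5 refl)
    (<-slack (1 + 9 * t) (solve 1 (λ t →
      con 1 :+ ((con 2 :+ t) :+ con 4) :* con 11 :+ (con 1 :+ con 9 :* t) := con 4 :* con 7 :+ con 2 :* ((con 2 :+ t) :* con 10)) refl t))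
    refl
  certificate 5 0 _ _ = certify 5 0 1 8 1  45 4  2 3 3  5 5 8
  certificate 5 (suc t) _ _ = certify-order+2 5 (1 + t) 5 8 8
    (<-slack (2 + 3 * t) (solve 1 (λ t →
      con 1 :+ (con 5 :+ (con 1 :+ t) :+ con 3) :* con 5 :+ (con 2 :+ con 3 :* t) := (con 1 :+ t) :* con 8 :+ con 5 :* con 8) refl t))
    (<-slack 0 refl)
    (<-slack (8 * t) (solve 1 (λ t →
      con 1 :+ ((con 1 :+ t) :+ con 4) :* con 8 :+ (con 8 :* t) := con 5 :* con 5 :+ con 2 :* ((con 1 :+ t) :* con 8)) refl t))
    refl
  certificate 6 0 _ _ = certify 6 0 1 10 1  27 2  2 3 3  3 3 5
  certificate 6 (suc t) _ _ = certify-order+2 6 (1 + t) 2 3 3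
    (<-slack (1 * t) (solve 1 (λ t →
      con 1 :+ (con 6 :+ (con 1 :+ t) :+ con 3) :* con 2 :+ (con 1 :* t) := (con 1 :+ t) :* con 3 :+ con 6 :* con 3) refl t))
    (<-slack 2 refl)
    (<-slack (2 + 3 * t) (solve 1 (λ t →
      con 1 :+ ((con 1 :+ t) :+ con 4) :* con 3 :+ (con 2 :+ con 3 :* t) := con 6 :* con 2 :+ con 2 :* ((con 1 :+ t) :* con 3)) refl t))
    refl
  -- With weights (2, 3, 3) the rows ask for s + t > 6, 2 s > 9 and 2 s + 3 t > 12, all consequences
  -- of s ≥ 7.
  certificate (suc (2+ (2+ (2+ s)))) t _ _ = certify-order+2 (7 + s) t 2 3 3
    (<-slack (1 * t + 1 * s) (solve 2 (λ s t →
      con 1 :+ ((con 7 :+ s) :+ t :+ con 3) :* con 2 :+ (con 1 :* t :+ con 1 :* s) := t :* con 3 :+ (con 7 :+ s) :* con 3) refl s t))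
    (<-slack (4 + 2 * s) (solve 2 (λ s t →
      con 1 :+ (con 2 :* (con 7 :+ s) :+ con 3) :* con 3 :+ (con 4 :+ con 2 :* s) := (con 7 :+ s) :* con 2 :+ con 2 :* ((con 7 :+ s) :* con 3)) refl s t))
    (<-slack (1 + 3 * t + 2 * s) (solve 2 (λ s t →
      con 1 :+ (t :+ con 4) :* con 3 :+ (con 1 :+ con 3 :* t :+ con 2 :* s) := (con 7 :+ s) :* con 2 :+ con 2 :* (t :* con 3)) refl s t))
    refl

  odd-excluded : ∀ {n} {A : Set} → {True (¬? (2 ∣? n))} → 2 ∣ n → A
  odd-excluded {_} {_} {n-odd} h = contradiction h (toWitness n-odd)

  too-large : ∀ {n} {A : Set} → 9 ≤ n → n ≤ 8 → A
  too-large 9≤n n≤8 = contradiction (≤-trans 9≤n n≤8) (from-yes (¬? (9 ≤? 8)))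

  order-mono : ∀ {a b s t} → a ≤ s → b ≤ t → a + (b + a) ≤ s + (t + s)
  order-mono a≤s b≤t = +-mono-≤ a≤s (+-mono-≤ b≤t a≤s)

  -- The target has no bulk vertices; its bulk weight only has to satisfy the
  -- vacuous bulk row.
  half-certificate : ∀ s t → 1 ≤ s → 1 ≤ t → 2 ∣ s + (t + s) → s + (t + s) ≤ 8 →
    Certificate (shape s t s) (shape ((s + (t + s)) / 2) 0 (s + (t + s) ∸ (s + (t + s)) / 2))
  half-certificate 0 _ () _ _ _
  half-certificate s 0 _ () _ _
  half-certificate 1 1 _ _ h _ = odd-excluded h
  -- For s = 1 the source is K₁ ∨ (K_{n-2} ∪ K₁) itself: at orders 4, 6 and 8 it lies above
  -- `S[ n , n / 2 ]`.
  half-certificate 1 2 _ _ _ _ = certify 1 2 2 0 2  15 4  3 4 5  3 5 4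
  half-certificate 1 3 _ _ h _ = odd-excluded h
  half-certificate 1 4 _ _ _ _ = certify 1 4 3 0 3  19 3  5 6 8  3 5 4
  half-certificate 1 5 _ _ h _ = odd-excluded h
  -- The two radii are close, about 8.778 against (9 + √73) / 2 ≈ 8.772, so the threshold 272 / 31 ≈
  -- 8.774 needs finer weights.
  half-certificate 1 6 _ _ _ _ = certify 1 6 4 0 4  272 31  68 80 117  43 69 62
  half-certificate 1 (suc (2+ (2+ (2+ t)))) _ _ _ h = too-large (order-mono {1} {7} ≤-refl (m≤m+n 7 t)) h
  half-certificate 2 1 _ _ h _ = odd-excluded h
  half-certificate 2 2 _ _ _ _ = certify 2 2 3 0 3  13 2  5 7 8  2 4 3
  half-certificate 2 3 _ _ h _ = odd-excluded h
  half-certificate 2 4 _ _ _ _ = certify 2 4 4 0 4  9 1  3 4 5  2 4 3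
  half-certificate 2 (suc (2+ (2+ t))) _ _ _ h = too-large (order-mono {2} {5} ≤-refl (m≤m+n 5 t)) h
  half-certificate 3 1 _ _ h _ = odd-excluded h
  half-certificate 3 2 _ _ _ _ = certify 3 2 4 0 4  9 1  4 6 7  2 4 3
  half-certificate 3 (suc (2+ t)) _ _ _ h = too-large (order-mono {3} {3} ≤-refl (m≤m+n 3 t)) h
  half-certificate (2+ (2+ s)) (suc t) _ _ _ h = too-large (order-mono {4} {1} (m≤m+n 4 s) (m≤m+n 1 t)) h

  -- Comparison with the extremal graphs.

  total-cong : ∀ {N N′} → (∀ x → N x ≡ N′ x) → ∀ g → total N g ≡ total N′ g
  total-cong h g = cong₂ _+_ (cong₂ _+_ (cong (_* g hub) (h hub)) (cong (_* g bulk) (h bulk))) (cong (_* g leaf) (h leaf))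

  certificate-exceeds : ∀ {n m N N′} (G : Graph n) (H : Graph m) (cls : Fin n → Class) (cls′ : Fin m → Class) →
    Connected G → Sublayered G cls → Superlayered H cls′ →
    (∀ x → count cls x ≡ N x) → (∀ x → count cls′ x ≡ N′ x) → 1 ≤ N hub → 1 ≤ N′ hub → Certificate N N′ →
    Exceeds G H
  certificate-exceeds G H cls cls′ conn sub sup cnt cnt′ hubs hubs′ c =
    let h , h-hub = count-witness cls′ hub (subst (1 ≤_) (sym (cnt′ hub)) hubs′)
    in layered-exceeds G H cls cls′ conn sub sup (subst (1 ≤_) (sym (cnt hub)) hubs) h h-hub
         p r r≥1 ω ω′ ω≥1 ω′≥1
         (λ x → subst (λ z → (p + r * distance x x) * ω x < r * z)
                  (sym (total-cong cnt (λ y → distance x y * ω y))) (above x))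
         (λ x → subst (λ z → r * z ≤ (p + r * distance x x) * ω′ x)
                  (sym (total-cong cnt′ (λ y → distance x y * ω′ y))) (below x))
    where open Certificate c

  Pendant : ∀ m → Graph (1 + (m + 1))
  Pendant m = K 1 ∨ᴳ (K m ∪ᴳ K 1)

  pendant-class : ∀ m → Fin (1 + (m + 1)) → Class
  pendant-class m = glue-class {1} (λ _ → hub) (glue-class {m} {1} (λ _ → bulk) (λ _ → leaf))

  pendant-superlayered : ∀ m → Superlayered (Pendant m) (pendant-class m)
  pendant-superlayered m = glue-superlayered true (K 1) (K m ∪ᴳ K 1) (complete-superlayered 1 (λ _ → hub))
    (glue-superlayered false (K m) (K 1) {λ _ → bulk} {λ _ → leaf}
      (complete-superlayered m (λ _ → bulk)) (complete-superlayered 1 (λ _ → leaf)) (λ _ _ ()) (λ _ _ ()))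
    (λ _ _ _ → tt) (λ _ _ _ → tt)

  pendant-count : ∀ m x → count (pendant-class m) x ≡ shape 1 m 1 x
  pendant-count m x = trans (count-glue {1} (λ _ → hub) (glue-class {m} {1} (λ _ → bulk) (λ _ → leaf)) x)
    (trans (cong (count {1} (λ _ → hub) x +_) (trans (count-glue {m} {1} (λ _ → bulk) (λ _ → leaf) x)
      (cong (_+ count {1} (λ _ → leaf) x) (count-const m bulk x)))) (evaluate x))
    where
    evaluate : ∀ x → count {1} (λ _ → hub) x + (m * indicator bulk x + count {1} (λ _ → leaf) x) ≡ shape 1 m 1 x
    evaluate hub  = solve 1 (λ m → con 1 :+ (m :* con 0 :+ con 0) := con 1) refl m
    evaluate bulk = solve 1 (λ m → con 0 :+ (m :* con 1 :+ con 0) := m) refl m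
    evaluate leaf = solve 1 (λ m → con 0 :+ (m :* con 0 :+ con 1) := con 1) refl m

  split-class : ∀ k c → Fin (k + c) → Class
  split-class k c = glue-class {k} {c} (λ _ → hub) (λ _ → leaf)

  split-superlayered : ∀ k c → Superlayered (K k ∨ᴳ edgeless c) (split-class k c)
  split-superlayered k c = glue-superlayered true (K k) (edgeless c) (complete-superlayered k (λ _ → hub))
    (edgeless-superlayered c) (λ _ _ _ → tt) (λ _ _ _ → tt)

  split-count : ∀ k c x → count (split-class k c) x ≡ shape k 0 c x
  split-count k c x = trans (count-glue {k} {c} (λ _ → hub) (λ _ → leaf) x)
    (trans (cong₂ _+_ (count-const k hub x) (count-const c leaf x)) (evaluate x))
    where
    evaluate : ∀ x → k * indicator hub x + c * indicator leaf x ≡ shape k 0 c x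
    evaluate hub  = solve 2 (λ k c → k :* con 1 :+ c :* con 0 := k) refl k c
    evaluate bulk = solve 2 (λ k c → k :* con 0 :+ c :* con 0 := con 0) refl k c
    evaluate leaf = solve 2 (λ k c → k :* con 0 :+ c :* con 1 := c) refl k c

  half : ∀ {n s t} → n ≡ s + (t + s) → t ≡ 0 → n / 2 ≡ s
  half {s = s} refl refl = trans (cong (_/ 2) (solve 1 (λ s → s :+ s := s :* con 2) refl s)) (m*n/n≡m s 2)

  half-complement : ∀ {n s t} → n ≡ s + (t + s) → t ≡ 0 → s ≡ n ∸ n / 2
  half-complement {s = s} refl refl = trans (sym (m+n∸n≡m s s)) (cong (s + s ∸_) (sym (half {s = s} refl refl)))

  shape-cong : ∀ {s t c s′ t′ c′} → s ≡ s′ → t ≡ t′ → c ≡ c′ → ∀ x → shape s t c x ≡ shape s′ t′ c′ x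
  shape-cong refl refl refl x = refl

  bulk-order : ∀ {n s} t → n ≡ s + (t + s) → s ≡ 1 → t ≡ n ∸ 2
  bulk-order t refl refl = sym (m+n∸n≡m t 1)

  module _ {k n} (2≤k : 2 ≤ k) (2∣k : 2 ∣ k) (G : Graph n) (conn : Connected G) where

    private
      Layering : Set
      Layering = ∃ λ cls → Sublayered G cls × ∃₂ λ s t → 1 ≤ s × n ≡ s + (t + s) × (∀ x → count cls x ≡ shape s t s x)

    -- For s = 1 the layering makes `G` a spanning subgraph of the extremal graph, and strict
    -- monotonicity decides, by non-isomorphism. For s ≥ 2 there is a numerical threshold between
    -- the two.
    layering-exceeds-pendant : Layering → ¬ 2 ∣ n ⊎ 10 ≤ n → ¬ G ≅ Pendant (n ∸ 2) →
      Exceeds G (Pendant (n ∸ 2))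
    layering-exceeds-pendant (cls , sub , s , t , s≥1 , n≡ , cnt) cond G≇H = go (s ≟ 1)
      where
      H = Pendant (n ∸ 2)
      go : Dec (s ≡ 1) → Exceeds G H
      go (yes s≡1) = spanning-exceeds G H cls (pendant-class (n ∸ 2)) conn sub (pendant-superlayered (n ∸ 2))
        (λ x → trans (cnt x) (trans (shape-cong s≡1 (bulk-order t n≡ s≡1) s≡1 x) (sym (pendant-count (n ∸ 2) x))))
        (subst (1 ≤_) (sym (cnt hub)) s≥1) G≇H
      go (no s≢1) = certificate-exceeds G H cls (pendant-class (n ∸ 2)) conn sub (pendant-superlayered (n ∸ 2))
        cnt (pendant-count (n ∸ 2)) s≥1 ≤-refl
        -- The order is rewritten as `s + (t + s)`, on which `certificate` is defined by cases.
        (subst (λ n → ¬ 2 ∣ n ⊎ 10 ≤ n → Certificate (shape s t s) (shape 1 (n ∸ 2) 1)) (sym n≡)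
          (certificate s t (≤∧≢⇒< s≥1 (s≢1 ∘ sym))) cond)

    -- The spanning case is now t = 0: without bulk vertices s is n / 2, and `G` lies inside
    -- `S[ n , n / 2 ]`.
    layering-exceeds-split : Layering → 2 ∣ n → 4 ≤ n → n ≤ 8 → ¬ G ≅ S[ n , n / 2 ] →
      Exceeds G S[ n , n / 2 ]
    layering-exceeds-split (cls , sub , s , t , s≥1 , n≡ , cnt) even 4≤n n≤8 G≇H = go (t ≟ 0)
      where
      H = S[ n , n / 2 ]
      go : Dec (t ≡ 0) → Exceeds G H
      go (yes t≡0) = spanning-exceeds G H cls (split-class (n / 2) (n ∸ n / 2)) conn sub
        (split-superlayered (n / 2) (n ∸ n / 2))
        (λ x → trans (cnt x) (trans (shape-cong (sym (half n≡ t≡0)) t≡0 (half-complement n≡ t≡0) x)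
          (sym (split-count (n / 2) (n ∸ n / 2) x))))
        (subst (1 ≤_) (sym (cnt hub)) s≥1) G≇H
      go (no t≢0) = certificate-exceeds G H cls (split-class (n / 2) (n ∸ n / 2)) conn sub
        (split-superlayered (n / 2) (n ∸ n / 2)) cnt (split-count (n / 2) (n ∸ n / 2)) s≥1
        (m≥n⇒m/n>0 {n} {2} (≤-trans (s≤s (s≤s z≤n)) 4≤n))
        (subst (λ n → 2 ∣ n → n ≤ 8 → Certificate (shape s t s) (shape (n / 2) 0 (n ∸ n / 2))) (sym n≡)
          (half-certificate s t s≥1 (n≢0⇒n>0 t≢0)) even n≤8)

    barrier-exceeds-pendant : ¬ 2 ∣ n ⊎ 10 ≤ n → ¬ G ≅ (K 1 ∨ᴳ (K (n ∸ 2) ∪ᴳ K 1)) →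
      (∃ λ S → Nonempty S × IsBarrier k G S) → Exceeds G (K 1 ∨ᴳ (K (n ∸ 2) ∪ᴳ K 1))
    barrier-exceeds-pendant cond G≇H barrier = layering-exceeds-pendant (barrier-layering 2≤k 2∣k G barrier) cond G≇H

    barrier-exceeds-split : 2 ∣ n → 4 ≤ n → n ≤ 8 → ¬ G ≅ S[ n , n / 2 ] →
      (∃ λ S → Nonempty S × IsBarrier k G S) → Exceeds G S[ n , n / 2 ]
    barrier-exceeds-split even 4≤n n≤8 G≇H barrier = layering-exceeds-split (barrier-layering 2≤k 2∣k G barrier) even 4≤n n≤8 G≇H

open import Data.Nat.Base using (ℕ; _≤_; _∸_)
open import Data.Nat.Divisibility using (_∣_)
open import Data.Nat.DivMod using (_/_)
open import Data.Product.Base using (_×_; _,_)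
open import Data.Sum.Base using (inj₁; inj₂)
open import Relation.Nullary using (¬_)
open import Defs hiding (_≤_)
open import Defs using () renaming (_≤_ to _≤ℝ_)
open Layerings using (refute; barrier-exceeds-pendant; barrier-exceeds-split)

theorem5 : ∀ (k n : ℕ) → 2 ≤ k → 2 ∣ k → 3 ≤ n → (G : Graph n) → Connected G →
    (∀ (α β : ℝ) → IsLargestEigenvalue (D G) α →
    IsLargestEigenvalue (D (K 1 ∨ᴳ (K (n ∸ 2) ∪ᴳ K 1))) β →
    α ≤ℝ β → ¬ G ≅ (K 1 ∨ᴳ (K (n ∸ 2) ∪ᴳ K 1)) →
    (¬ 2 ∣ n → GFC k G) × (2 ∣ n → 10 ≤ n → GBC k G))
    ×
    (2 ∣ n → 4 ≤ n → n ≤ 8 →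
    ∀ (α β : ℝ) → IsLargestEigenvalue (D G) α →
    IsLargestEigenvalue (D S[ n , n / 2 ]) β →
    α ≤ℝ β → ¬ G ≅ S[ n , n / 2 ] → GBC k G)
theorem5 k n 2≤k 2∣k _ G conn =
  (λ α β α-largest β-largest α≤β G≇H →
    (λ odd → conn , odd , λ barrier → refute (barrier-exceeds-pendant 2≤k 2∣k G conn (inj₁ odd) G≇H barrier) α β α-largest β-largest α≤β) ,
    (λ even 10≤n → conn , even , λ barrier → refute (barrier-exceeds-pendant 2≤k 2∣k G conn (inj₂ 10≤n) G≇H barrier) α β α-largest β-largest α≤β)) ,
  (λ even 4≤n n≤8 α β α-largest β-largest α≤β G≇H →
    conn , even , λ barrier → refute (barrier-exceeds-split 2≤k 2∣k G conn even 4≤n n≤8 G≇H barrier) α β α-largest β-largest α≤β)
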